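{- Let $G$ be a connected finite simple graph of order $p$ and size $q=p+1$ with normal graph algebra $\mathcal{N}G$ over a field $\mathbb{F}$ of characteristic not $2$, such that every set of two distinct edges of $G$ is the support of $u^2$ for some $u\in U_G$. Then $G$ is not edge-square, and $G$ is a doubly-odd paddle graph. Moreover, every doubly-odd paddle graph has the property that every set of two distinct edges is the support of $u^2$ for some $u\in U_G$.
   Context: For a finite simple graph $G$ with vertex set $VG$ and edge set $EG$, $\mathcal{N}G=U_G\oplus\mathfrak{Z}_G$ with $U_G$ having basis $VG$ and $\mathfrak{Z}_G$ basis $EG$ (edge with endpoints $x,y$ written $[x,y]$), commutative bilinear product determined by: for distinct vertices $x,y$, $xy=[x,y]$ if adjacent and $0$ otherwise; $x^2=\sum_{y\sim x}[x,y]$; products involving $\mathfrak{Z}_G$ are $0$. Equivalently, for $u=\sum_x\theta_x x$, $u^2=\sum_{[x,y]\in EG}(\theta_x+\theta_y)^2[x,y]$. The support of $\mathfrak{z}\in\mathfrak{Z}_G$ is the set of edges with nonzero coefficient. $G$ is edge-square if for every edge $\mathfrak{e}$ there is $u\in U_G$ with $u^2=\mathfrak{e}$. A doubly-odd paddle graph is a graph consisting of two edge-disjoint cycles of odd length which either share exactly one vertex, or are vertex-disjoint and joined by a path between a vertex of one and a vertex of the other whose internal vertices lie on neither cycle (and nothing else). -}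

module Defs where

open import Level using (Level; 0ℓ; _⊔_)
open import Algebra.Apartness.Bundles using (HeytingField; HeytingCommutativeRing)
open import Algebra.Bundles using (CommutativeRing)
import Algebra.Properties.CommutativeMonoid.Sum as Sum
open import Data.Bool.Base using (Bool; false; T; if_then_else_)
open import Data.Fin.Base using (Fin; zero; suc; inject₁; fromℕ; _<_)
open import Data.Fin.Properties using (_≟_)
open import Data.Nat.Base as ℕ using (ℕ; suc)
open import Data.Nat.Divisibility using (_∣_)
open import Data.Product using (∃; ∃-syntax; ∃!; _×_; _,_)
open import Data.Sum.Base using (_⊎_)
open import Function.Bundles using (_↔_)
open import Function.Definitions using (Injective)
open import Relation.Binary.Construct.Closure.ReflexiveTransitive using (Star)
open import Relation.Binary.PropositionalEquality using (_≡_; _≢_)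
open import Relation.Nullary using (¬_; Dec; does)
open import Relation.Nullary.Decidable using (_×-dec_; _⊎-dec_)
open import Relation.Unary using (Pred; _≐_; _∪_; ｛_｝)

Odd : ℕ → Set
Odd n = ¬ (2 ∣ n)

-- p is the order: the vertex set is Fin p.

record Graph (p : ℕ) : Set where
  field
    adj        : Fin p → Fin p → Bool
    adj-sym    : ∀ x y → adj x y ≡ adj y x
    adj-irrefl : ∀ x → adj x x ≡ false

  _∼_ : Fin p → Fin p → Set
  x ∼ y = T (adj x y)

-- The unordered pair {lo , hi} is stored with lo < hi, and both proof
-- components are propositions, so that each edge occurs exactly once
-- and _≡_ is equality of edges.

record Edge {p : ℕ} (G : Graph p) : Set where
  constructor edge
  open Graph G
  field
    lo hi : Fin p
    lo<hi : lo < hi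
    lo∼hi : lo ∼ hi

module _ {p : ℕ} (G : Graph p) where
  open Graph G

  Connected : Set
  Connected = ∀ x y → Star _∼_ x y

  HasSize : ℕ → Set
  HasSize q = Fin q ↔ Edge G

  Joins : Edge G → Fin p → Fin p → Set
  Joins e x y = (lo ≡ x × hi ≡ y) ⊎ (lo ≡ y × hi ≡ x)
    where open Edge e

  joins? : ∀ e x y → Dec (Joins e x y)
  joins? e x y = ((lo ≟ x) ×-dec (hi ≟ y)) ⊎-dec ((lo ≟ y) ×-dec (hi ≟ x))
    where open Edge e

  -- A path with m edges, hence with m + 1 pairwise distinct vertices.

  record Path (m : ℕ) : Set where
    field
      vertex    : Fin (suc m) → Fin p
      injective : Injective _≡_ _≡_ vertex
      step      : ∀ (i : Fin m) → vertex (inject₁ i) ∼ vertex (suc i)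

    start end : Fin p
    start = vertex zero
    end   = vertex (fromℕ m)

    VertexOf : Pred (Fin p) 0ℓ
    VertexOf x = ∃[ i ] vertex i ≡ x

    InternalVertexOf : Pred (Fin p) 0ℓ
    InternalVertexOf x = ∃[ i ] i ≢ zero × i ≢ fromℕ m × vertex i ≡ x

    EdgeOf : Pred (Edge G) 0ℓ
    EdgeOf e = ∃[ i ] Joins e (vertex (inject₁ i)) (vertex (suc i))

  -- A cycle is a path with at least two edges together with an edge of G
  -- from its end back to its start.

  record Cycle : Set where
    field
      {m}    : ℕ
      arc    : Path m
      2≤m    : 2 ℕ.≤ m
      closes : Path.end arc ∼ Path.start arc

    length : ℕ
    length = suc m

    VertexOf : Pred (Fin p) 0ℓ
    VertexOf = Path.VertexOf arc

    EdgeOf : Pred (Edge G) 0ℓ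
    EdgeOf e = Path.EdgeOf arc e ⊎ Joins e (Path.end arc) (Path.start arc)

  module _ (C D : Cycle) where
    private
      module C = Cycle C
      module D = Cycle D

    EdgeDisjoint : Set
    EdgeDisjoint = ∀ e → ¬ (C.EdgeOf e × D.EdgeOf e)

    VertexDisjoint : Set
    VertexDisjoint = ∀ x → ¬ (C.VertexOf x × D.VertexOf x)

    ShareExactlyOneVertex : Set
    ShareExactlyOneVertex = ∃! _≡_ λ x → C.VertexOf x × D.VertexOf x

    record JoinedBy {m : ℕ} (P : Path m) : Set where
      private module P = Path P
      field
        start∈C  : C.VertexOf P.start
        end∈D    : D.VertexOf P.end
        internal : ∀ x → P.InternalVertexOf x →
                   ¬ C.VertexOf x × ¬ D.VertexOf x

    TouchingUnion : Set
    TouchingUnion =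
        ShareExactlyOneVertex
      × (∀ x → C.VertexOf x ⊎ D.VertexOf x)
      × (∀ e → C.EdgeOf e ⊎ D.EdgeOf e)

    JoinedUnion : Set
    JoinedUnion =
        VertexDisjoint
      × ∃[ m ] ∃[ P ] JoinedBy {m} P
        × (∀ x → C.VertexOf x ⊎ D.VertexOf x ⊎ Path.VertexOf P x)
        × (∀ e → C.EdgeOf e ⊎ D.EdgeOf e ⊎ Path.EdgeOf P e)

  IsDoublyOddPaddle : Set
  IsDoublyOddPaddle =
    ∃[ C ] ∃[ D ] Odd (Cycle.length C) × Odd (Cycle.length D)
                × EdgeDisjoint C D
                × (TouchingUnion C D ⊎ JoinedUnion C D)

-- In a Heyting field x # y holds exactly when x - y is invertible, and
-- x ≈ y exactly when x # y fails; "nonzero" is therefore _# 0#.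

CharacteristicNot2 : ∀ {c ℓ₁ ℓ₂} → HeytingField c ℓ₁ ℓ₂ → Set ℓ₂
CharacteristicNot2 F = (1# + 1#) # 0#
  where open HeytingField F

module NormalGraphAlgebra
  {c ℓ₁ ℓ₂ : Level} (F : HeytingField c ℓ₁ ℓ₂) {p : ℕ} (G : Graph p) where

  open HeytingField F
  open HeytingCommutativeRing heytingCommutativeRing using (commutativeRing)
  open CommutativeRing commutativeRing using (+-commutativeMonoid)
  open Sum +-commutativeMonoid using (sum-syntax)
  open Graph G

  -- Coordinates with respect to the bases VG and EG.

  U Z N : Set c
  U = Fin p → Carrier
  Z = Edge G → Carrier
  N = U × Z

  infix 4 _≈ᴺ_
  _≈ᴺ_ : N → N → Set ℓ₁
  (u , z) ≈ᴺ (u′ , z′) = (∀ x → u x ≈ u′ x) × (∀ e → z e ≈ z′ e)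

  0ᵁ : U
  0ᵁ _ = 0#

  0ᶻ : Z
  0ᶻ _ = 0#

  fromU : U → N
  fromU u = u , 0ᶻ

  fromZ : Z → N
  fromZ z = 0ᵁ , z

  -- The basis vector [x,y] of Z when x and y are adjacent.

  ⟦_,_⟧ : Fin p → Fin p → Z
  ⟦ x , y ⟧ e = if does (joins? G e x y) then 1# else 0#

  basisVector : Edge G → Z
  basisVector e = ⟦ Edge.lo e , Edge.hi e ⟧

  ⟦_,_⟧-ifAdjacent : Fin p → Fin p → Z
  ⟦ x , y ⟧-ifAdjacent = if adj x y then ⟦ x , y ⟧ else 0ᶻ

  vertexProduct : Fin p → Fin p → Z
  vertexProduct x y =
    if does (x ≟ y)
    then (λ e → ∑[ w < p ] ⟦ x , w ⟧-ifAdjacent e)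
    else ⟦ x , y ⟧-ifAdjacent

  infixl 7 _·_
  _·_ : N → N → N
  (u , _) · (v , _) =
    fromZ (λ e → ∑[ x < p ] ∑[ y < p ] (u x * v y * vertexProduct x y e))

  infix 8 _²
  _² : U → N
  u ² = fromU u · fromU u

  Support : Z → Pred (Edge G) ℓ₂
  Support z e = z e # 0#

  IsSupportOfSquare : Pred (Edge G) 0ℓ → Set (c ⊔ ℓ₁ ⊔ ℓ₂)
  IsSupportOfSquare S = ∃[ u ] ∃[ z ] (u ² ≈ᴺ fromZ z) × (Support z ≐ S)

  EdgeSquare : Set (c ⊔ ℓ₁)
  EdgeSquare = ∀ (e : Edge G) → ∃[ u ] (u ² ≈ᴺ fromZ (basisVector e))

  EveryEdgePairIsSupportOfSquare : Set (c ⊔ ℓ₁ ⊔ ℓ₂)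
  EveryEdgePairIsSupportOfSquare =
    ∀ (e f : Edge G) → e ≢ f → IsSupportOfSquare (｛ e ｝ ∪ ｛ f ｝)

{-# OPTIONS --safe #-}
module Submission where

-- The coefficient of u² at an edge [x,y] is (u x + u y)², so only the supports of the
-- edge functions u x + u y matter.
--
-- Let G be connected with p + 1 edges, and fix a rooted spanning tree, coloured by the
-- parity of the depth.  Two edges e and f lie outside the tree.  If u x + u y vanishes on
-- all tree edges, then u is determined up to a scalar and alternates with the colour; if it
-- vanishes on all tree edges but one, then u alternates with one scalar on each side of that
-- edge.  Applied to the u with support {e , g}, this shows that e and f have ends of equal
-- colour, that there is no third edge outside the tree, that no u² has support {e}, and that
-- no tree edge g splits the ends of e and those of f in the same way.  The fundamental
-- cycles of e and f are therefore odd, share at most one vertex and, together with a path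
-- between them, contain every edge.
--
-- Conversely, being the support of some u² is a transitive relation on pairs of edges (take
-- linear combinations).  In a paddle every edge is related to the closing edge of one
-- cycle, through a u that alternates on a suitable connected part.

open import Defs
open import Algebra.Apartness.Bundles using (HeytingCommutativeRing; HeytingField)
import Algebra.Apartness.Properties.HeytingCommutativeRing as HeytingProperties
open import Algebra.Bundles using (CommutativeMonoid; CommutativeRing)
import Algebra.Properties.CommutativeSemigroup as CommutativeSemigroupProperties
import Algebra.Properties.Ring as RingProperties
import Algebra.Properties.Semiring.Sum as SemiringSum
open import Data.Bool.Base using (Bool; T; _xor_; _∨_; false; if_then_else_; not; true)
open import Data.Bool.Properties
  using (T-irrelevant; not-distribˡ-xor; not-injective; not-involutive; not-¬; xor-same;
         ¬-not)
  renaming (_≟_ to _≟ᵇ_)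
open import Data.Empty using (⊥)
open import Data.Fin.Base using (Fin; _<_; fromℕ; inject₁; suc; toℕ; zero)
open import Data.Fin.Properties
  using (<-asym; <-cmp; <-irrefl; <-irrelevant; _≟_; any?; pigeonhole; toℕ-fromℕ;
         toℕ-injective; toℕ-inject₁; toℕ<n; ¬∀⟶∃¬)
open import Data.Nat.Base as ℕ using (_≤_; suc; s≤s; zero; z≤n; ℕ)
open import Data.Nat.Divisibility using (_∣_; divides)
import Data.Nat.Properties as ℕₚ
open import Data.Product using (_,_; _×_; proj₁; proj₂; ∃-syntax; ∃₂)
open import Data.Sum.Base as Sum using ([_,_]′; _⊎_; inj₁; inj₂)
open import Data.Unit.Base using (tt; ⊤)
open import Function.Base using (_∘_; id)
open import Function.Bundles using (Inverse)
open import Function.Definitions using (Injective)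
open import Level using (_⊔_)
open import Relation.Binary.Construct.Closure.ReflexiveTransitive as Star
  using (Star; _◅_; _◅◅_; ε)
open import Relation.Binary.Definitions using (tri<; tri>; tri≈)
open import Relation.Binary.PropositionalEquality as ≡
  using (_≡_; _≢_; cong; refl; subst; subst₂)
open import Relation.Nullary using (Dec; contradiction; does; no; yes; ¬_)
open import Relation.Nullary.Decidable
  using (T?; _×-dec_; _⊎-dec_; dec-false; dec-true; map′; ¬?)
open import Relation.Unary using (_∪_; ｛_｝)

module _ {p : ℕ} {G : Graph p} where
  open Graph G
  open Edge

  edge-≡ : ∀ {e f : Edge G} → lo e ≡ lo f → hi e ≡ hi f → e ≡ f
  edge-≡ {edge l h l<h l∼h} {edge .l .h l<h′ l∼h′} refl refl
    rewrite <-irrelevant l<h l<h′ | T-irrelevant l∼h l∼h′ = refl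

  infix 4 _≟ᴱ_
  _≟ᴱ_ : (e f : Edge G) → Dec (e ≡ f)
  e ≟ᴱ f = map′ (λ (l , h) → edge-≡ l h) (λ { refl → refl , refl })
                ((lo e ≟ lo f) ×-dec (hi e ≟ hi f))

  lo≢hi : (e : Edge G) → lo e ≢ hi e
  lo≢hi e l≡h = <-irrefl l≡h (lo<hi e)

  ∼-sym : ∀ {x y} → x ∼ y → y ∼ x
  ∼-sym {x} {y} = subst T (adj-sym x y)

  ∼⇒≢ : ∀ {x y} → x ∼ y → x ≢ y
  ∼⇒≢ {x} x∼x refl rewrite adj-irrefl x = x∼x

  joins-self : (e : Edge G) → Joins G e (lo e) (hi e)
  joins-self e = inj₁ (refl , refl)

  joins-sym : ∀ {e x y} → Joins G e x y → Joins G e y x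
  joins-sym (inj₁ j) = inj₂ j
  joins-sym (inj₂ j) = inj₁ j

  joins⇒∼ : ∀ {e x y} → Joins G e x y → x ∼ y
  joins⇒∼ {e} (inj₁ (refl , refl)) = lo∼hi e
  joins⇒∼ {e} (inj₂ (refl , refl)) = ∼-sym (lo∼hi e)

  joins-unique : ∀ {e f x y} → Joins G e x y → Joins G f x y → e ≡ f
  joins-unique (inj₁ (refl , refl)) (inj₁ (l , h)) = edge-≡ (≡.sym l) (≡.sym h)
  joins-unique {e} {f} (inj₁ (refl , refl)) (inj₂ (refl , refl)) =
    contradiction (lo<hi f) (<-asym (lo<hi e))
  joins-unique {e} {f} (inj₂ (refl , refl)) (inj₁ (refl , refl)) =
    contradiction (lo<hi f) (<-asym (lo<hi e))
  joins-unique (inj₂ (refl , refl)) (inj₂ (l , h)) = edge-≡ (≡.sym l) (≡.sym h)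

  joins-endpoints : ∀ {e x y s t} → Joins G e x y → Joins G e s t →
                    (x ≡ s × y ≡ t) ⊎ (x ≡ t × y ≡ s)
  joins-endpoints (inj₁ (refl , refl)) k = k
  joins-endpoints (inj₂ (refl , refl)) (inj₁ (a , b)) = inj₂ (b , a)
  joins-endpoints (inj₂ (refl , refl)) (inj₂ (a , b)) = inj₁ (b , a)

  ∼⇒edge : ∀ {x y} → x ∼ y → ∃[ e ] Joins G e x y
  ∼⇒edge {x} {y} x∼y with <-cmp x y
  ... | tri< x<y _ _ = edge x y x<y x∼y , inj₁ (refl , refl)
  ... | tri≈ _ x≡y _ = contradiction x≡y (∼⇒≢ x∼y)
  ... | tri> _ _ y<x = edge y x y<x (∼-sym x∼y) , inj₂ (refl , refl)

module HeytingFieldProperties {c ℓ₁ ℓ₂} (F : HeytingField c ℓ₁ ℓ₂) where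
  open HeytingField F renaming (refl to ≈-refl)
  open HeytingCommutativeRing heytingCommutativeRing using (commutativeRing)
  open CommutativeRing commutativeRing using (ring)
  open HeytingProperties heytingCommutativeRing public
    using (x-0≈x; 1#0; x#0y#0→xy#0; #-congʳ; invertibleʳ⇒#)
  open RingProperties ring
    using (-‿involutive; -‿distribʳ-*)

  ¬#0⇒≈0 : ∀ {x} → ¬ x # 0# → x ≈ 0#
  ¬#0⇒≈0 {x} = proj₁ (tight x 0#)

  ≈0⇒¬#0 : ∀ {x} → x ≈ 0# → ¬ x # 0#
  ≈0⇒¬#0 {x} = proj₂ (tight x 0#)

  xy#0⇒x#0 : ∀ {x y} → x * y # 0# → x # 0#
  xy#0⇒x#0 {x} {y} xy#0 with #⇒invertible xy#0
  ... | w , _ , xy*w≈1 = invertibleʳ⇒# (y * w , trans (*-congʳ (x-0≈x x))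
          (trans (sym (*-assoc x y w)) (trans (*-congʳ (sym (x-0≈x (x * y)))) xy*w≈1)))

  -x#0 : ∀ {x} → x # 0# → - x # 0#
  -x#0 {x} x#0 = xy#0⇒x#0 (#-congʳ (begin
    x                 ≈⟨ -‿involutive x ⟨
    - - x             ≈⟨ -‿cong (*-identityʳ (- x)) ⟨
    - (- x * 1#)      ≈⟨ -‿distribʳ-* (- x) 1# ⟩
    - x * - 1#        ∎) x#0)
    where open import Relation.Binary.Reasoning.Setoid setoid

  x#0∧xy≈0⇒y≈0 : ∀ {x y} → x # 0# → x * y ≈ 0# → y ≈ 0#
  x#0∧xy≈0⇒y≈0 x#0 xy≈0 = ¬#0⇒≈0 λ y#0 → ≈0⇒¬#0 xy≈0 (x#0y#0→xy#0 x#0 y#0)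

  x²≈0⇒x≈0 : ∀ {x} → x * x ≈ 0# → x ≈ 0#
  x²≈0⇒x≈0 x²≈0 = ¬#0⇒≈0 λ x#0 → ≈0⇒¬#0 x²≈0 (x#0y#0→xy#0 x#0 x#0)

  sgn : Bool → Carrier
  sgn false = 1#
  sgn true  = - 1#

  sgn#0 : ∀ b → sgn b # 0#
  sgn#0 false = 1#0
  sgn#0 true  = -x#0 1#0

  sgn-not : ∀ b → sgn (not b) ≈ - sgn b
  sgn-not false = ≈-refl
  sgn-not true  = sym (-‿involutive 1#)

  sgn+sgn-not : ∀ b → sgn b + sgn (not b) ≈ 0#
  sgn+sgn-not b = trans (+-congˡ (sgn-not b)) (-‿inverseʳ (sgn b))

module SquareSupport
  {c ℓ₁ ℓ₂} (F : HeytingField c ℓ₁ ℓ₂) {p : ℕ} (G : Graph p) where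
  open HeytingField F hiding (zero) renaming (refl to ≈-refl)
  open HeytingCommutativeRing heytingCommutativeRing using (commutativeRing)
  open CommutativeRing commutativeRing using (semiring)
  open SemiringSum semiring
  open NormalGraphAlgebra F G
  open HeytingFieldProperties F
  open Graph G
  open Edge
  open import Relation.Binary.Reasoning.Setoid setoid

  edgeValue : U → Edge G → Carrier
  edgeValue u h = u (lo h) + u (hi h)

  edgeValue-joins : ∀ u {h x y} → Joins G h x y → edgeValue u h ≈ u x + u y
  edgeValue-joins u (inj₁ (refl , refl)) = ≈-refl
  edgeValue-joins u (inj₂ (refl , refl)) = +-comm _ _

  indicator : ∀ {n} → Fin n → Fin n → Carrier
  indicator k x = if does (k ≟ x) then 1# else 0#

  sum-zero : ∀ {n} (t : Fin n → Carrier) → (∀ i → t i ≈ 0#) → sum t ≈ 0#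
  sum-zero {n} t t≈0 = trans (sum-cong-≋ t≈0) (sum-replicate-zero n)

  indicator-suc : ∀ {n} (k x : Fin n) → indicator (suc k) (suc x) ≈ indicator k x
  indicator-suc k x with k ≟ x
  ... | yes _ = ≈-refl
  ... | no  _ = ≈-refl

  sum-indicator : ∀ {n} (t : Fin n → Carrier) k →
                  sum (λ x → t x * indicator k x) ≈ t k
  sum-indicator {suc n} t zero = begin
    t zero * 1# + sum (λ x → t (suc x) * 0#)
      ≈⟨ +-cong (*-identityʳ _) (sum-zero {n} (λ x → t (suc x) * 0#) λ x → zeroʳ (t (suc x))) ⟩
    t zero + 0#                               ≈⟨ +-identityʳ _ ⟩
    t zero                                    ∎
  sum-indicator {suc n} t (suc k) = begin
    t zero * 0# + sum (λ x → t (suc x) * indicator (suc k) (suc x))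
      ≈⟨ +-cong (zeroʳ (t zero))
           (sum-cong-≋ {n} {λ x → t (suc x) * indicator (suc k) (suc x)}
                       {λ x → t (suc x) * indicator k x}
                       (λ x → *-congˡ {t (suc x)} (indicator-suc k x))) ⟩
    0# + sum (λ x → t (suc x) * indicator k x) ≈⟨ +-identityˡ _ ⟩
    sum (λ x → t (suc x) * indicator k x)      ≈⟨ sum-indicator (t ∘ suc) k ⟩
    t (suc k)                                 ∎

  private
    ι : ∀ {a} {P : Set a} → Dec P → Carrier
    ι P? = if does P? then 1# else 0#

    ι-× : ∀ {P Q : Set} (P? : Dec P) (Q? : Dec Q) → ι (P? ×-dec Q?) ≈ ι P? * ι Q?
    ι-× (yes _) Q? = sym (*-identityˡ _)
    ι-× (no  _) Q? = sym (zeroˡ _)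

    ι-⊎ : ∀ {P Q : Set} (P? : Dec P) (Q? : Dec Q) → ¬ (P × Q) →
          ι (P? ⊎-dec Q?) ≈ ι P? + ι Q?
    ι-⊎ (yes P) (yes Q) ¬PQ = contradiction (P , Q) ¬PQ
    ι-⊎ (yes _) (no  _) _   = sym (+-identityʳ _)
    ι-⊎ (no  _) Q?      _   = sym (+-identityˡ _)

    ι-zero : ∀ {P : Set} (P? : Dec P) → ¬ P → ι P? ≈ 0#
    ι-zero (yes P) ¬P = contradiction P ¬P
    ι-zero (no  _) _  = ≈-refl

    ι-one : ∀ {P : Set} (P? : Dec P) → P → ι P? ≈ 1#
    ι-one (yes _) _ = ≈-refl
    ι-one (no ¬P) P = contradiction P ¬P

    ι-idem : ∀ {P : Set} (P? : Dec P) → ι P? * ι P? ≈ ι P?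
    ι-idem (yes _) = *-identityˡ _
    ι-idem (no  _) = zeroˡ _

  ⟦,⟧-joins : ∀ x y h → ⟦ x , y ⟧-ifAdjacent h ≈ ι (joins? G h x y)
  ⟦,⟧-joins x y h with adj x y in x≁y
  ... | true  = ≈-refl
  ... | false = sym (ι-zero (joins? G h x y) λ j → subst T x≁y (joins⇒∼ {G = G} {h} j))

  basisVector-self : ∀ e → basisVector e e ≈ 1#
  basisVector-self e = ι-one (joins? G e (lo e) (hi e)) (joins-self e)

  basisVector-other : ∀ {e h} → h ≢ e → basisVector e h ≈ 0#
  basisVector-other {e} {h} h≢e = ι-zero (joins? G h (lo e) (hi e))
    λ j → h≢e (joins-unique {e = h} {e} j (joins-self e))

  ⟦,⟧-coefficient : ∀ x y h → ⟦ x , y ⟧-ifAdjacent h ≈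
    indicator (lo h) x * indicator (hi h) y + indicator (hi h) x * indicator (lo h) y
  ⟦,⟧-coefficient x y h = begin
    ⟦ x , y ⟧-ifAdjacent h                       ≈⟨ ⟦,⟧-joins x y h ⟩
    ι (joins? G h x y)
      ≈⟨ ι-⊎ ((lo h ≟ x) ×-dec (hi h ≟ y)) ((lo h ≟ y) ×-dec (hi h ≟ x))
             (λ { ((lx , _) , (_ , hx)) → lo≢hi h (≡.trans lx (≡.sym hx)) }) ⟩
    ι ((lo h ≟ x) ×-dec (hi h ≟ y)) + ι ((lo h ≟ y) ×-dec (hi h ≟ x))
      ≈⟨ +-cong (ι-× (lo h ≟ x) (hi h ≟ y)) (trans (ι-× (lo h ≟ y) (hi h ≟ x)) (*-comm _ _)) ⟩
    indicator (lo h) x * indicator (hi h) y + indicator (hi h) x * indicator (lo h) y ∎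

  incidence : Edge G → U
  incidence h x = indicator (lo h) x + indicator (hi h) x

  private
    expand : ∀ {a b c d} → a * c ≈ 0# → b * d ≈ 0# → (a + b) * (c + d) ≈ a * d + b * c
    expand {a} {b} {c} {d} ac≈0 bd≈0 = begin
      (a + b) * (c + d)                 ≈⟨ distribʳ (c + d) a b ⟩
      a * (c + d) + b * (c + d)         ≈⟨ +-cong (distribˡ a c d) (distribˡ b c d) ⟩
      (a * c + a * d) + (b * c + b * d) ≈⟨ +-cong (+-congʳ ac≈0) (+-congˡ bd≈0) ⟩
      (0# + a * d) + (b * c + 0#)       ≈⟨ +-cong (+-identityˡ _) (+-identityʳ _) ⟩
      a * d + b * c                     ∎

    indicator-disjointˡ : ∀ k {x y : Fin p} → x ≢ y → indicator k x * indicator k y ≈ 0#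
    indicator-disjointˡ k {x} {y} x≢y = trans (sym (ι-× (k ≟ x) (k ≟ y)))
      (ι-zero ((k ≟ x) ×-dec (k ≟ y)) λ { (refl , refl) → x≢y refl })

    indicator-disjointʳ : ∀ {k l} (x : Fin p) → k ≢ l → indicator k x * indicator l x ≈ 0#
    indicator-disjointʳ {k} {l} x k≢l = trans (sym (ι-× (k ≟ x) (l ≟ x)))
      (ι-zero ((k ≟ x) ×-dec (l ≟ x)) λ { (refl , refl) → k≢l refl })

  vertexProduct-incidence : ∀ x y h → vertexProduct x y h ≈ incidence h x * incidence h y
  vertexProduct-incidence x y h with x ≟ y
  ... | no x≢y = trans (⟦,⟧-coefficient x y h)
        (sym (expand (indicator-disjointˡ (lo h) x≢y) (indicator-disjointˡ (hi h) x≢y)))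
  ... | yes refl = begin
    ∑[ w < p ] ⟦ x , w ⟧-ifAdjacent h
      ≈⟨ sum-cong-≋ (λ w → ⟦,⟧-coefficient x w h) ⟩
    ∑[ w < p ] (a * indicator (hi h) w + b * indicator (lo h) w)
      ≈⟨ ∑-distrib-+ (λ w → a * indicator (hi h) w) (λ w → b * indicator (lo h) w) ⟩
    ∑[ w < p ] (a * indicator (hi h) w) + ∑[ w < p ] (b * indicator (lo h) w)
      ≈⟨ +-cong (sum-indicator (λ _ → a) (hi h)) (sum-indicator (λ _ → b) (lo h)) ⟩
    a + b
      ≈⟨ +-cong (ι-idem (lo h ≟ x)) (ι-idem (hi h ≟ x)) ⟨
    a * a + b * b
      ≈⟨ expand (indicator-disjointʳ x (lo≢hi h)) (indicator-disjointʳ x (lo≢hi h ∘ ≡.sym)) ⟨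
    (a + b) * (b + a)
      ≈⟨ *-congˡ (+-comm b a) ⟩
    (a + b) * (a + b) ∎
    where
    a = indicator (lo h) x
    b = indicator (hi h) x

  sum-incidence : ∀ u h → ∑[ x < p ] (u x * incidence h x) ≈ edgeValue u h
  sum-incidence u h = begin
    ∑[ x < p ] (u x * incidence h x)
      ≈⟨ sum-cong-≋ (λ x → distribˡ (u x) _ _) ⟩
    ∑[ x < p ] (u x * indicator (lo h) x + u x * indicator (hi h) x)
      ≈⟨ ∑-distrib-+ (λ x → u x * indicator (lo h) x) (λ x → u x * indicator (hi h) x) ⟩
    ∑[ x < p ] (u x * indicator (lo h) x) + ∑[ x < p ] (u x * indicator (hi h) x)
      ≈⟨ +-cong (sum-indicator u (lo h)) (sum-indicator u (hi h)) ⟩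
    edgeValue u h ∎

  square-coefficient : ∀ u h → proj₂ (u ²) h ≈ edgeValue u h * edgeValue u h
  square-coefficient u h = begin
    ∑[ x < p ] ∑[ y < p ] (u x * u y * vertexProduct x y h)
      ≈⟨ sum-cong-≋ (λ x → sum-cong-≋ (λ y → rearranged x y)) ⟩
    ∑[ x < p ] ∑[ y < p ] (v x * v y)
      ≈⟨ sum-cong-≋ (λ x → sym (*-distribˡ-sum (v x) v)) ⟩
    ∑[ x < p ] (v x * sum v)
      ≈⟨ *-distribʳ-sum (sum v) v ⟨
    sum v * sum v
      ≈⟨ *-cong (sum-incidence u h) (sum-incidence u h) ⟩
    edgeValue u h * edgeValue u h ∎
    where
    v : U
    v x = u x * incidence h x
    rearranged : ∀ x y → u x * u y * vertexProduct x y h ≈ v x * v y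
    rearranged x y = trans (*-congˡ (vertexProduct-incidence x y h))
      (CommutativeSemigroupProperties.interchange
        (CommutativeRing.*-commutativeSemigroup commutativeRing)
        (u x) (u y) (incidence h x) (incidence h y))

  record SupportedOnPair (u : U) (e f : Edge G) : Set (ℓ₁ ⊔ ℓ₂) where
    field
      first#0  : edgeValue u e # 0#
      second#0 : edgeValue u f # 0#
      others≈0 : ∀ h → h ≢ e → h ≢ f → edgeValue u h ≈ 0#

  pairSupport⇒supportedOnPair : ∀ {e f} → IsSupportOfSquare (｛ e ｝ ∪ ｛ f ｝) →
                                ∃[ u ] SupportedOnPair u e f
  pairSupport⇒supportedOnPair (u , z , (_ , u²≈z) , support⊆ , ⊆support) = u , record
    { first#0  = value#0 (⊆support (inj₁ refl))
    ; second#0 = value#0 (⊆support (inj₂ refl))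
    ; others≈0 = λ h h≢e h≢f → x²≈0⇒x≈0 (trans (sym (square-coefficient u h))
        (trans (u²≈z h) (¬#0⇒≈0 λ zh#0 →
          [ h≢e ∘ ≡.sym , h≢f ∘ ≡.sym ]′ (support⊆ zh#0))))
    }
    where
    value#0 : ∀ {h} → z h # 0# → edgeValue u h # 0#
    value#0 {h} zh#0 =
      xy#0⇒x#0 (#-congʳ (trans (sym (u²≈z h)) (square-coefficient u h)) zh#0)

  supportedOnPair⇒pairSupport : ∀ {u e f} → SupportedOnPair u e f →
                                IsSupportOfSquare (｛ e ｝ ∪ ｛ f ｝)
  supportedOnPair⇒pairSupport {u} {e} {f} s =
    u , proj₂ (u ²) , ((λ _ → ≈-refl) , λ _ → ≈-refl) , support⊆ , ⊆support
    where
    open SupportedOnPair s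
    square#0 : ∀ {h} → edgeValue u h # 0# → proj₂ (u ²) h # 0#
    square#0 {h} v#0 = #-congʳ (sym (square-coefficient u h)) (x#0y#0→xy#0 v#0 v#0)
    ⊆support : ∀ {h} → (｛ e ｝ ∪ ｛ f ｝) h → Support (proj₂ (u ²)) h
    ⊆support (inj₁ refl) = square#0 first#0
    ⊆support (inj₂ refl) = square#0 second#0
    support⊆ : ∀ {h} → Support (proj₂ (u ²)) h → (｛ e ｝ ∪ ｛ f ｝) h
    support⊆ {h} u²h#0 with e ≟ᴱ h | f ≟ᴱ h
    ... | yes e≡h | _       = inj₁ e≡h
    ... | no  _   | yes f≡h = inj₂ f≡h
    ... | no  e≢h | no  f≢h = contradiction
      (xy#0⇒x#0 (#-congʳ (square-coefficient u h) u²h#0))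
      (≈0⇒¬#0 (others≈0 h (e≢h ∘ ≡.sym) (f≢h ∘ ≡.sym)))

odd? : ℕ → Bool
odd? zero    = false
odd? (suc n) = not (odd? n)

least : ∀ {ℓ} {P : ℕ → Set ℓ} → (∀ n → Dec (P n)) → ∀ n → P n →
        ∃[ m ] P m × (∀ k → P k → m ≤ k)
least P? n Pn with P? 0
... | yes P0 = 0 , P0 , λ _ _ → z≤n
... | no ¬P0 with n
...   | zero  = contradiction Pn ¬P0
...   | suc n′ with m , Pm , min ← least (P? ∘ suc) n′ Pn =
          suc m , Pm , λ { zero P0 → contradiction P0 ¬P0 ; (suc k) Pk → s≤s (min k Pk) }

record RootedSpanningTree {p : ℕ} (G : Graph p) : Set where
  open Graph G
  field
    root         : Fin p
    parent       : Fin p → Fin p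
    depth        : Fin p → ℕ
    parent-adj   : ∀ {x} → x ≢ root → x ∼ parent x
    depth-parent : ∀ {x} → x ≢ root → depth x ≡ suc (depth (parent x))

  colour : Fin p → Bool
  colour x = odd? (depth x)

  infix 4 _⌢_ _⌢?_
  _⌢_ : Fin p → Fin p → Set
  x ⌢ y = (x ≢ root × y ≡ parent x) ⊎ (y ≢ root × x ≡ parent y)

  _⌢?_ : ∀ x y → Dec (x ⌢ y)
  x ⌢? y = (¬? (x ≟ root) ×-dec (y ≟ parent x)) ⊎-dec (¬? (y ≟ root) ×-dec (x ≟ parent y))

  ⌢-sym : ∀ {x y} → x ⌢ y → y ⌢ x
  ⌢-sym = Sum.swap

  ⌢⇒∼ : ∀ {x y} → x ⌢ y → x ∼ y
  ⌢⇒∼ (inj₁ (x≢r , refl)) = parent-adj x≢r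
  ⌢⇒∼ (inj₂ (y≢r , refl)) = ∼-sym {G = G} (parent-adj y≢r)

  TreeEdge : Edge G → Set
  TreeEdge h = Edge.lo h ⌢ Edge.hi h

  joins⇒⌢ : ∀ {h x y} → TreeEdge h → Joins G h x y → x ⌢ y
  joins⇒⌢ t (inj₁ (refl , refl)) = t
  joins⇒⌢ t (inj₂ (refl , refl)) = ⌢-sym t

  parentEdge : ∀ {h x} → x ≢ root → Joins G h x (parent x) → TreeEdge h
  parentEdge x≢r (inj₁ (refl , hi≡)) = inj₁ (x≢r , hi≡)
  parentEdge x≢r (inj₂ (lo≡ , refl)) = inj₂ (x≢r , lo≡)

  parent-parent : ∀ {x} → x ≢ root → parent x ≢ root → parent (parent x) ≢ x
  parent-parent x≢r px≢r ppx≡x = ℕₚ.1+n≰n (ℕₚ.≤-trans (ℕₚ.n≤1+n _) (ℕₚ.≤-reflexive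
    (≡.trans (≡.sym (cong suc (depth-parent px≢r)))
      (≡.trans (≡.sym (depth-parent x≢r)) (cong depth (≡.sym ppx≡x))))))

  colour-parent : ∀ {x} → x ≢ root → colour x ≡ not (colour (parent x))
  colour-parent x≢r = cong odd? (depth-parent x≢r)

  depth-induction : ∀ {ℓ} (P : Fin p → Set ℓ) → P root →
                    (∀ x → x ≢ root → P (parent x) → P x) → ∀ x → P x
  depth-induction P base step x = go (depth x) x ℕₚ.≤-refl
    where
    go : ∀ n y → depth y ≤ n → P y
    go n y d≤n with y ≟ root
    ... | yes refl = base
    ... | no y≢r with n | subst (_≤ n) (depth-parent y≢r) d≤n
    ...   | suc n′ | s≤s d≤n′ = step y y≢r (go n′ (parent y) d≤n′)

  -- Descendants of x, x included: the side of the edge from x to its parent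
  -- that does not contain the root.

  data Descendant (x : Fin p) : Fin p → Set where
    self  : Descendant x x
    child : ∀ {y} → y ≢ root → Descendant x (parent y) → Descendant x y

  descendant-parent : ∀ {x y} → y ≢ x → Descendant x y → Descendant x (parent y)
  descendant-parent y≢x self        = contradiction refl y≢x
  descendant-parent _   (child _ d) = d

  descendant-root : ∀ {x} → Descendant x root → x ≡ root
  descendant-root self          = refl
  descendant-root (child r≢r _) = contradiction refl r≢r

  descendant? : ∀ x y → Dec (Descendant x y)
  descendant? x = depth-induction (λ y → Dec (Descendant x y)) atRoot atChild
    where
    atRoot : Dec (Descendant x root)
    atRoot = map′ (λ { refl → self }) descendant-root (x ≟ root)
    atChild : ∀ y → y ≢ root → Dec (Descendant x (parent y)) → Dec (Descendant x y)
    atChild y y≢r parent? with y ≟ x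
    ... | yes refl = yes self
    ... | no y≢x   = map′ (child y≢r) (descendant-parent y≢x) parent?

  descendant-depth : ∀ {x y} → Descendant x y → depth x ≤ depth y
  descendant-depth self = ℕₚ.≤-refl
  descendant-depth (child y≢r d) rewrite depth-parent y≢r = ℕₚ.m≤n⇒m≤1+n (descendant-depth d)

  abstract
    below : Fin p → Fin p → Bool
    below x y = does (descendant? x y)

    below-yes : ∀ {x y} → Descendant x y → below x y ≡ true
    below-yes {x} {y} d with descendant? x y
    ... | yes _  = refl
    ... | no ¬d = contradiction d ¬d

    below-no : ∀ {x y} → ¬ Descendant x y → below x y ≡ false
    below-no {x} {y} ¬d with descendant? x y
    ... | yes d = contradiction d ¬d
    ... | no _  = refl

  below-root : ∀ {x} → x ≢ root → below x root ≡ false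
  below-root x≢r = below-no (x≢r ∘ descendant-root)

  below-parent : ∀ {x y} → y ≢ root → y ≢ x → below x y ≡ below x (parent y)
  below-parent {x} {y} y≢r y≢x with descendant? x (parent y)
  ... | yes d = ≡.trans (below-yes (child y≢r d)) (≡.sym (below-yes d))
  ... | no ¬d = ≡.trans (below-no (¬d ∘ descendant-parent y≢x)) (≡.sym (below-no ¬d))

  crossing : ∀ {x y z} → y ⌢ z → below x y ≢ below x z →
             (y ≡ x × z ≡ parent x) ⊎ (z ≡ x × y ≡ parent x)
  crossing {x} {y} (inj₁ (y≢r , refl)) cross with y ≟ x
  ... | yes refl = inj₁ (refl , refl)
  ... | no y≢x   = contradiction (below-parent y≢r y≢x) cross
  crossing {x} {y} {z} (inj₂ (z≢r , refl)) cross with z ≟ x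
  ... | yes refl = inj₂ (refl , refl)
  ... | no z≢x   = contradiction (≡.sym (below-parent z≢r z≢x)) cross

  separator : ∀ {s t} → s ≢ t → ∃[ x ] x ≢ root × below x s ≢ below x t
  separator {s} {t} s≢t with descendant? t s
  ... | no ¬d = t , (λ { refl → ¬d (fromRoot s) }) ,
                λ eq → contradiction
                  (≡.trans (≡.sym (below-no ¬d)) (≡.trans eq (below-yes (self {t})))) λ ()
    where
    fromRoot : ∀ y → Descendant root y
    fromRoot = depth-induction (Descendant root) self (λ _ → child)
  ... | yes self = contradiction refl s≢t
  ... | yes (child s≢r d) = s , s≢r ,
                λ eq → contradiction
                  (≡.trans (≡.sym (below-yes (self {s}))) (≡.trans eq (below-no ¬d′))) λ ()
    where
    ¬d′ : ¬ Descendant s t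
    ¬d′ d′ = ℕₚ.<-irrefl refl (ℕₚ.≤-trans
      (ℕₚ.≤-reflexive (≡.sym (depth-parent s≢r)))
      (ℕₚ.≤-trans (descendant-depth d′) (descendant-depth d)))

spanningTree : ∀ {p} {G : Graph p} → Connected G → Fin p → RootedSpanningTree G
spanningTree {p} {G} connected r = record
  { root         = r
  ; parent       = parent
  ; depth        = depth
  ; parent-adj   = λ {x} x≢r → proj₁ (parent-props x x≢r)
  ; depth-parent = λ {x} x≢r → proj₂ (parent-props x x≢r)
  }
  where
  open Graph G
  Reach : ℕ → Fin p → Set
  Reach zero    x = x ≡ r
  Reach (suc n) x = ∃[ y ] x ∼ y × Reach n y

  reach? : ∀ n x → Dec (Reach n x)
  reach? zero    x = x ≟ r
  reach? (suc n) x = any? λ y → T? (adj x y) ×-dec reach? n y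

  reach : ∀ {x} → Star _∼_ x r → ∃[ n ] Reach n x
  reach ε         = 0 , refl
  reach (x∼y ◅ w) with n , Rn ← reach w = suc n , _ , x∼y , Rn

  distance : ∀ x → ∃[ n ] Reach n x × (∀ k → Reach k x → n ≤ k)
  distance x with n , Rn ← reach (connected x r) = least (λ n → reach? n x) n Rn

  depth : Fin p → ℕ
  depth x = proj₁ (distance x)

  next : ∀ x → ∃[ y ] (x ≢ r → x ∼ y × depth x ≡ suc (depth y))
  next x with distance x
  ... | zero  , x≡r , _ = x , contradiction x≡r
  ... | suc n , (y , x∼y , Rn) , min = y , λ _ → x∼y , cong suc (ℕₚ.≤-antisym
          (ℕₚ.≤-pred (min (suc (depth y)) (y , x∼y , proj₁ (proj₂ (distance y)))))
          (proj₂ (proj₂ (distance y)) n Rn))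

  parent : Fin p → Fin p
  parent x = proj₁ (next x)

  parent-props : ∀ x → x ≢ r → x ∼ parent x × depth x ≡ suc (depth (parent x))
  parent-props x = proj₂ (next x)

module _ {p : ℕ} {G : Graph p} (S : RootedSpanningTree G) where
  open RootedSpanningTree S

  private
    label : Edge G → Fin p
    label h with Edge.lo h ⌢? Edge.hi h
    ... | yes (inj₁ _) = Edge.lo h
    ... | yes (inj₂ _) = Edge.hi h
    ... | no _         = root

    label-root : ∀ h → label h ≡ root → ¬ TreeEdge h
    label-root h l≡r with Edge.lo h ⌢? Edge.hi h
    ... | yes (inj₁ (x≢r , _)) = contradiction l≡r x≢r
    ... | yes (inj₂ (x≢r , _)) = contradiction l≡r x≢r
    ... | no ¬t = ¬t

    label-joins : ∀ h → label h ≢ root → Joins G h (label h) (parent (label h))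
    label-joins h l≢r with Edge.lo h ⌢? Edge.hi h
    ... | yes (inj₁ (_ , h≡p)) = inj₁ (refl , h≡p)
    ... | yes (inj₂ (_ , l≡p)) = inj₂ (l≡p , refl)
    ... | no _ = contradiction refl l≢r

  -- A tree edge is determined by its lower end, which is not the root; so of
  -- p + 1 edges two are outside the tree.

  two-nontree-edges : HasSize G (p ℕ.+ 1) →
    ∃[ e ] ∃[ f ] e ≢ f × ¬ TreeEdge e × ¬ TreeEdge f
  two-nontree-edges size with pigeonhole p<p+1 (label ∘ Inverse.to size)
    where
    p<p+1 : p ℕ.< p ℕ.+ 1
    p<p+1 = ℕₚ.≤-reflexive (ℕₚ.+-comm 1 p)
  ... | i , j , i<j , same = e , f , e≢f , label-root e l≡r , label-root f (≡.trans (≡.sym same) l≡r)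
    where
    e f : Edge G
    e = Inverse.to size i
    f = Inverse.to size j
    e≢f : e ≢ f
    e≢f e≡f = <-irrefl (≡.trans (≡.sym (Inverse.strictlyInverseʳ size i))
      (≡.trans (cong (Inverse.from size) e≡f) (Inverse.strictlyInverseʳ size j))) i<j
    l≡r : label e ≡ root
    l≡r with label e ≟ root
    ... | yes eq = eq
    ... | no l≢r = contradiction (joins-unique {e = e} {f}
          (label-joins e l≢r)
          (subst (λ l → Joins G f l (parent l)) (≡.sym same)
            (label-joins f (l≢r ∘ ≡.trans same)))) e≢f

SamePair : Bool → Bool → Bool → Bool → Set
SamePair a b c d = (a ≡ c × b ≡ d) ⊎ (a ≡ d × b ≡ c)

record IsNontreePair {p : ℕ} {G : Graph p} (S : RootedSpanningTree G) (e f : Edge G) : Set where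
  open RootedSpanningTree S
  open Edge
  field
    monochromaticᵉ : colour (lo e) ≡ colour (hi e)
    monochromaticᶠ : colour (lo f) ≡ colour (hi f)
    nontree-only   : ∀ h → ¬ TreeEdge h → h ≡ e ⊎ h ≡ f
    cut            : ∀ x → x ≢ root →
      ¬ SamePair (below x (lo e)) (below x (hi e)) (below x (lo f)) (below x (hi f))

module TreePotential {c ℓ₁ ℓ₂} (F : HeytingField c ℓ₁ ℓ₂)
  {p : ℕ} {G : Graph p} (S : RootedSpanningTree G) where
  open HeytingField F hiding (zero) renaming (refl to ≈-refl; reflexive to ≈-reflexive)
  open HeytingCommutativeRing heytingCommutativeRing using (commutativeRing)
  open CommutativeRing commutativeRing using (ring)
  open RingProperties ring using (-‿distribˡ-*; -‿involutive; +-inverseˡ-unique)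
  open NormalGraphAlgebra F G
  open HeytingFieldProperties F
  open SquareSupport F G
  open RootedSpanningTree S
  open Edge
  open import Relation.Binary.Reasoning.Setoid setoid

  sgn*sgn* : ∀ b x → sgn b * (sgn b * x) ≈ x
  sgn*sgn* false x = trans (*-identityˡ _) (*-identityˡ x)
  sgn*sgn* true  x = begin
    - 1# * (- 1# * x) ≈⟨ -‿distribˡ-* 1# _ ⟨
    - (1# * (- 1# * x)) ≈⟨ -‿cong (*-identityˡ _) ⟩
    - (- 1# * x)      ≈⟨ -‿cong (-‿distribˡ-* 1# x) ⟨
    - - (1# * x)      ≈⟨ -‿involutive _ ⟩
    1# * x            ≈⟨ *-identityˡ x ⟩
    x                 ∎

  record Alternating (u : U) (side : Fin p → Bool) (k : Bool → Carrier) : Set ℓ₁ where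
    constructor alternates
    field at : ∀ y → u y ≈ sgn (colour y) * k (side y)

  open Alternating

  alternating : ∀ u side k → u root ≈ sgn (colour root) * k (side root) →
    (∀ y → y ≢ root → (u y + u (parent y) ≈ 0# × side y ≡ side (parent y))
                    ⊎ u y ≈ sgn (colour y) * k (side y)) →
    Alternating u side k
  alternating u side k base rule =
    alternates (depth-induction (λ y → u y ≈ sgn (colour y) * k (side y)) base step)
    where
    step : ∀ y → y ≢ root → u (parent y) ≈ sgn (colour (parent y)) * k (side (parent y)) →
           u y ≈ sgn (colour y) * k (side y)
    step y y≢r ih with rule y y≢r
    ... | inj₂ known = known
    ... | inj₁ (vanish , same) = begin
      u y                                              ≈⟨ +-inverseˡ-unique _ _ vanish ⟩
      - u (parent y)                                   ≈⟨ -‿cong ih ⟩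
      - (sgn (colour (parent y)) * k (side (parent y))) ≈⟨ -‿distribˡ-* _ _ ⟩
      - sgn (colour (parent y)) * k (side (parent y))  ≈⟨ *-congʳ (sgn-not (colour (parent y))) ⟨
      sgn (not (colour (parent y))) * k (side (parent y))
        ≡⟨ ≡.cong₂ (λ b s → sgn b * k s) (colour-parent y≢r) same ⟨
      sgn (colour y) * k (side y)                      ∎

  VanishesOnTree : U → Set ℓ₁
  VanishesOnTree u = ∀ h → TreeEdge h → edgeValue u h ≈ 0#

  alternating-tree : ∀ u → VanishesOnTree u → ∃[ k ] Alternating u (λ _ → false) k
  alternating-tree u vanish = k₀ ,
    alternating u (λ _ → false) k₀ (sym (sgn*sgn* (colour root) _)) λ y y≢r →
      inj₁ (parentValue y y≢r , refl)
    where
    k₀ : Bool → Carrier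
    k₀ _ = sgn (colour root) * u root
    parentValue : ∀ y → y ≢ root → u y + u (parent y) ≈ 0#
    parentValue y y≢r with h , j ← ∼⇒edge {G = G} (parent-adj y≢r) =
      trans (sym (edgeValue-joins u {h} j)) (vanish h (parentEdge {h} y≢r j))

  alternating-cut : ∀ u x → x ≢ root →
    (∀ h → TreeEdge h → ¬ Joins G h x (parent x) → edgeValue u h ≈ 0#) →
    ∃[ k ] Alternating u (below x) k
  alternating-cut u x x≢r vanish = k , alternating u (below x) k atRoot rule
    where
    k : Bool → Carrier
    k false = sgn (colour root) * u root
    k true  = sgn (colour x) * u x
    atRoot : u root ≈ sgn (colour root) * k (below x root)
    atRoot rewrite below-root x≢r = sym (sgn*sgn* (colour root) _)
    rule : ∀ y → y ≢ root → (u y + u (parent y) ≈ 0# × below x y ≡ below x (parent y))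
                          ⊎ u y ≈ sgn (colour y) * k (below x y)
    rule y y≢r with y ≟ x
    ... | yes refl = inj₂ (sym (trans (≈-reflexive (cong (λ b → sgn (colour x) * k b)
                            (below-yes (self {x})))) (sgn*sgn* (colour x) _)))
    ... | no y≢x with h , j ← ∼⇒edge {G = G} (parent-adj y≢r) =
      inj₁ (trans (sym (edgeValue-joins u {h} j)) (vanish h (parentEdge {h} y≢r j) notCut)
           , below-parent y≢r y≢x)
      where
      notCut : ¬ Joins G h x (parent x)
      notCut j′ with joins-endpoints {G = G} {h} j j′
      ... | inj₁ (y≡x , _) = y≢x y≡x
      ... | inj₂ (refl , py≡x) = parent-parent x≢r y≢r py≡x

  alternating-monochromatic : ∀ {u side k} → Alternating u side k → ∀ {h} →
    colour (lo h) ≡ colour (hi h) →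
    edgeValue u h ≈ sgn (colour (lo h)) * (k (side (lo h)) + k (side (hi h)))
  alternating-monochromatic {u} {side} {k} alt {h} mono = begin
    u (lo h) + u (hi h) ≈⟨ +-cong (at alt (lo h)) (at alt (hi h)) ⟩
    sgn (colour (lo h)) * k (side (lo h)) + sgn (colour (hi h)) * k (side (hi h))
      ≡⟨ cong (λ b → sgn (colour (lo h)) * k (side (lo h)) + sgn b * k (side (hi h))) mono ⟨
    sgn (colour (lo h)) * k (side (lo h)) + sgn (colour (lo h)) * k (side (hi h))
      ≈⟨ distribˡ _ _ _ ⟨
    sgn (colour (lo h)) * (k (side (lo h)) + k (side (hi h))) ∎

  alternating-bichromatic : ∀ {u k} → Alternating u (λ _ → false) k → ∀ {h} →
    colour (lo h) ≢ colour (hi h) → edgeValue u h ≈ 0#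
  alternating-bichromatic {u} {k} alt {h} bi = begin
    u (lo h) + u (hi h) ≈⟨ +-cong (at alt (lo h)) (at alt (hi h)) ⟩
    sgn (colour (lo h)) * k false + sgn (colour (hi h)) * k false ≈⟨ distribʳ _ _ _ ⟨
    (sgn (colour (lo h)) + sgn (colour (hi h))) * k false
      ≡⟨ cong (λ b → (sgn (colour (lo h)) + sgn b) * k false) (≡.sym (¬-not (bi ∘ ≡.sym))) ⟨
    (sgn (colour (lo h)) + sgn (not (colour (lo h)))) * k false
      ≈⟨ *-congʳ (sgn+sgn-not (colour (lo h))) ⟩
    0# * k false ≈⟨ zeroˡ _ ⟩
    0# ∎

  samePair-sum : ∀ (k : Bool → Carrier) {a b c d} → SamePair a b c d → k a + k b ≈ k c + k d
  samePair-sum k (inj₁ (refl , refl)) = ≈-refl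
  samePair-sum k (inj₂ (refl , refl)) = +-comm _ _

  transfer : ∀ {u side k} → Alternating u side k → ∀ {e f} →
    colour (lo e) ≡ colour (hi e) → colour (lo f) ≡ colour (hi f) →
    SamePair (side (lo e)) (side (hi e)) (side (lo f)) (side (hi f)) →
    edgeValue u f ≈ 0# → edgeValue u e ≈ 0#
  transfer {u} {side} {k} alt {e} {f} monoᵉ monoᶠ same f≈0 = begin
    edgeValue u e ≈⟨ alternating-monochromatic alt {e} monoᵉ ⟩
    sgn (colour (lo e)) * (k (side (lo e)) + k (side (hi e)))
      ≈⟨ *-congˡ (samePair-sum k same) ⟩
    sgn (colour (lo e)) * (k (side (lo f)) + k (side (hi f)))
      ≈⟨ *-congˡ (x#0∧xy≈0⇒y≈0 (sgn#0 (colour (lo f)))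
           (trans (sym (alternating-monochromatic alt {f} monoᶠ)) f≈0)) ⟩
    sgn (colour (lo e)) * 0# ≈⟨ zeroʳ _ ⟩
    0# ∎

  module _ (pairs : EveryEdgePairIsSupportOfSquare)
           {e f : Edge G} (e≢f : e ≢ f) (ntᵉ : ¬ TreeEdge e) (ntᶠ : ¬ TreeEdge f) where

    private
      monochromatic : colour (lo e) ≡ colour (hi e) × colour (lo f) ≡ colour (hi f)
      monochromatic = mono {e} first#0 , mono {f} second#0
        where
        us = pairSupport⇒supportedOnPair (pairs e f e≢f)
        u = proj₁ us
        open SupportedOnPair (proj₂ us)
        alt = proj₂ (alternating-tree u λ h t →
          others≈0 h (λ { refl → ntᵉ t }) (λ { refl → ntᶠ t }))
        mono : ∀ {h} → edgeValue u h # 0# → colour (lo h) ≡ colour (hi h)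
        mono {h} h#0 with colour (lo h) ≟ᵇ colour (hi h)
        ... | yes eq = eq
        ... | no neq = contradiction h#0 (≈0⇒¬#0 (alternating-bichromatic alt {h} neq))

      monoᵉ = proj₁ monochromatic
      monoᶠ = proj₂ monochromatic

    isNontreePair : IsNontreePair S e f
    isNontreePair = record
      { monochromaticᵉ = monoᵉ ; monochromaticᶠ = monoᶠ
      ; nontree-only = nontree-only ; cut = cut }
      where
      nontree-only : ∀ h → ¬ TreeEdge h → h ≡ e ⊎ h ≡ f
      nontree-only h nt with h ≟ᴱ e | h ≟ᴱ f
      ... | yes h≡e | _       = inj₁ h≡e
      ... | no  _   | yes h≡f = inj₂ h≡f
      ... | no  h≢e | no  h≢f = contradiction first#0 (≈0⇒¬#0
          (transfer (proj₂ (alternating-tree u λ g t →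
              others≈0 g (λ { refl → ntᵉ t }) (λ { refl → nt t })))
            {e} {f} monoᵉ monoᶠ (inj₁ (refl , refl))
            (others≈0 f (e≢f ∘ ≡.sym) (h≢f ∘ ≡.sym))))
        where
        us = pairSupport⇒supportedOnPair (pairs e h (h≢e ∘ ≡.sym))
        u = proj₁ us
        open SupportedOnPair (proj₂ us)

      cut : ∀ x → x ≢ root →
        ¬ SamePair (below x (lo e)) (below x (hi e)) (below x (lo f)) (below x (hi f))
      cut x x≢r same with g , j ← ∼⇒edge {G = G} (parent-adj x≢r) =
        ≈0⇒¬#0 (transfer (proj₂ (alternating-cut u x x≢r λ h t ¬j →
              others≈0 h (λ { refl → ntᵉ t }) (λ { refl → ¬j j })))
            {e} {f} monoᵉ monoᶠ same (others≈0 f (e≢f ∘ ≡.sym) (λ { refl → ntᶠ treeᵍ })))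
          first#0
        where
        treeᵍ : TreeEdge g
        treeᵍ = parentEdge {g} x≢r j
        us = pairSupport⇒supportedOnPair (pairs e g λ { refl → ntᵉ treeᵍ })
        u = proj₁ us
        open SupportedOnPair (proj₂ us)

    not-edgeSquare : ¬ EdgeSquare
    not-edgeSquare edgeSquare with u , _ , u²≈e ← edgeSquare e =
      ≈0⇒¬#0 (trans (sym (basisVector-self e)) (trans (sym (u²≈e e))
        (trans (square-coefficient u e) (trans (*-congʳ e≈0) (zeroˡ _))))) 1#0
      where
      others≈0 : ∀ h → h ≢ e → edgeValue u h ≈ 0#
      others≈0 h h≢e = x²≈0⇒x≈0 (trans (sym (square-coefficient u h))
        (trans (u²≈e h) (basisVector-other h≢e)))
      e≈0 : edgeValue u e ≈ 0#
      e≈0 = transfer (proj₂ (alternating-tree u λ h t → others≈0 h λ { refl → ntᵉ t }))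
        {e} {f} monoᵉ monoᶠ (inj₁ (refl , refl)) (others≈0 f (e≢f ∘ ≡.sym))

odd?⇒Odd : ∀ {n} → odd? n ≡ true → Odd n
odd?⇒Odd {n} o (divides q n≡q*2) =
  contradiction (≡.trans (≡.sym o) (≡.trans (cong odd? n≡q*2) (even q))) λ ()
  where
  even : ∀ q → odd? (q ℕ.* 2) ≡ false
  even zero    = refl
  even (suc q) rewrite even q = refl

module _ {p : ℕ} {R : Fin p → Fin p → Set} where
  private variable
    x y v : Fin p

  walkLength : Star R x y → ℕ
  walkLength ε       = 0
  walkLength (_ ◅ w) = suc (walkLength w)

  vertexAt : (w : Star R x y) → Fin (suc (walkLength w)) → Fin p
  vertexAt {x} _       zero    = x
  vertexAt     (_ ◅ w) (suc i) = vertexAt w i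

  infix 4 _∈_ _∈?_
  _∈_ : Fin p → Star R x y → Set
  v ∈ w = ∃[ i ] vertexAt w i ≡ v

  _∈?_ : ∀ v (w : Star R x y) → Dec (v ∈ w)
  v ∈? w = any? λ i → vertexAt w i ≟ v

  vertexAt-end : (w : Star R x y) → vertexAt w (fromℕ (walkLength w)) ≡ y
  vertexAt-end ε       = refl
  vertexAt-end (_ ◅ w) = vertexAt-end w

  vertexAt-step : (w : Star R x y) (i : Fin (walkLength w)) →
                  R (vertexAt w (inject₁ i)) (vertexAt w (suc i))
  vertexAt-step (r ◅ ε)       zero    = r
  vertexAt-step (r ◅ (_ ◅ _)) zero    = r
  vertexAt-step (_ ◅ w)       (suc i) = vertexAt-step w i

  Simple : Star R x y → Set
  Simple ε               = ⊤
  Simple (_◅_ {x} r w) = ¬ x ∈ w × Simple w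

  vertexAt-injective : (w : Star R x y) → Simple w → Injective _≡_ _≡_ (vertexAt w)
  vertexAt-injective ε       _         {zero}  {zero}  _  = refl
  vertexAt-injective (_ ◅ w) _         {zero}  {zero}  _  = refl
  vertexAt-injective (_ ◅ w) (x∉w , _) {zero}  {suc j} eq = contradiction (j , ≡.sym eq) x∉w
  vertexAt-injective (_ ◅ w) (x∉w , _) {suc i} {zero}  eq = contradiction (i , eq) x∉w
  vertexAt-injective (_ ◅ w) (_ , s)   {suc i} {suc j} eq = cong suc (vertexAt-injective w s eq)

  suffix : (w : Star R x y) → Simple w → v ∈ w → ∃[ w′ ] Simple {v} {y} w′
  suffix w       s       (zero  , refl) = w , s
  suffix (_ ◅ w) (_ , s) (suc i , v∈w)  = suffix w s (i , v∈w)

  loopErase : Star R x y → ∃[ w ] Simple {x} {y} w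
  loopErase ε = ε , tt
  loopErase {x} (r ◅ w) with w′ , s ← loopErase w with x ∈? w′
  ... | yes x∈w′ = suffix w′ s x∈w′
  ... | no  x∉w′ = r ◅ w′ , x∉w′ , s

  record PrefixToFirst (Q : Fin p → Set) (w : Star R x y) : Set where
    field
      {end}     : Fin p
      walk      : Star R x end
      simple    : Simple walk
      end∈Q     : Q end
      earlier∉Q : ∀ i → i ≢ fromℕ (walkLength walk) → ¬ Q (vertexAt walk i)
      prefix⊆   : ∀ {v} → v ∈ walk → v ∈ w

  prefixToFirst : ∀ {Q : Fin p → Set} → (∀ v → Dec (Q v)) →
                  (w : Star R x y) → Simple w → Q y → PrefixToFirst Q w
  prefixToFirst {x = x} Q? w s Qy with Q? x
  ... | yes Qx = record
    { walk = ε ; simple = tt ; end∈Q = Qx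
    ; earlier∉Q = λ { zero i≢end _ → i≢end refl }
    ; prefix⊆   = λ { (zero , refl) → zero , refl } }
  prefixToFirst Q? ε s Qy | no ¬Qx = contradiction Qy ¬Qx
  prefixToFirst Q? (r ◅ w) (x∉w , s) Qy | no ¬Qx = record
    { walk = r ◅ walk ; simple = x∉w ∘ prefix⊆ , simple ; end∈Q = end∈Q
    ; earlier∉Q = λ { zero _ → ¬Qx ; (suc i) i≢end → earlier∉Q i (i≢end ∘ cong suc) }
    ; prefix⊆   = λ { (zero , refl) → zero , refl
                    ; (suc i , eq) → let j , eq′ = prefix⊆ (i , eq) in suc j , eq′ } }
    where open PrefixToFirst (prefixToFirst Q? w s Qy)

  record Connector (P Q : Fin p → Set) : Set where
    field
      {start end} : Fin p
      walk        : Star R start end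
      simple      : Simple walk
      start∈P     : P start
      end∈Q       : Q end
      internal    : ∀ i → i ≢ zero → i ≢ fromℕ (walkLength walk) →
                    ¬ P (vertexAt walk i) × ¬ Q (vertexAt walk i)

  connector : ∀ {P Q : Fin p → Set} → (∀ v → Dec (P v)) → (∀ v → Dec (Q v)) →
              (w : Star R x y) → Simple w → ∃[ i ] P (vertexAt w i) → Q y → Connector P Q
  connector P? Q? ε s (zero , Px) Qx = record
    { walk = ε ; simple = tt ; start∈P = Px ; end∈Q = Qx
    ; internal = λ { zero i≢0 _ → contradiction refl i≢0 } }
  connector P? Q? (r ◅ w) (x∉w , s) some Qy with any? (P? ∘ vertexAt w)
  ... | yes later = connector P? Q? w s later Qy
  connector P? Q? (r ◅ w) (x∉w , s) (suc i , Pv) Qy | no none = contradiction (i , Pv) none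
  connector {P = P} P? Q? (r ◅ w) (x∉w , s) (zero , Px) Qy | no none = record
    { walk = r ◅ walk ; simple = x∉w ∘ prefix⊆ , simple ; start∈P = Px ; end∈Q = end∈Q
    ; internal = λ { zero i≢0 _ → contradiction refl i≢0
                   ; (suc i) _ i≢end →
                       (λ Pv → let j , eq = prefix⊆ (i , refl) in none (j , subst P (≡.sym eq) Pv))
                     , earlier∉Q i (i≢end ∘ cong suc) } }
    where open PrefixToFirst (prefixToFirst Q? w s Qy)

  toPath : ∀ {G : Graph p} → (∀ {x y} → R x y → Graph._∼_ G x y) →
           (w : Star R x y) → Simple w → Path G (walkLength w)
  toPath R⇒∼ w s = record
    { vertex    = vertexAt w
    ; injective = vertexAt-injective w s
    ; step      = λ i → R⇒∼ (vertexAt-step w i)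
    }

crossing-index : ∀ {m} (f : Fin (suc m) → Bool) i j → f i ≢ f j →
                 ∃[ k ] f (inject₁ k) ≢ f (suc k)
crossing-index {m} f i j fi≢fj = ¬∀⟶∃¬ m _ (λ k → f (inject₁ k) ≟ᵇ f (suc k))
  λ eq → fi≢fj (≡.trans (constant f eq i) (≡.sym (constant f eq j)))
  where
  constant : ∀ {m} (f : Fin (suc m) → Bool) → (∀ k → f (inject₁ k) ≡ f (suc k)) →
             ∀ i → f i ≡ f zero
  constant         f eq zero    = refl
  constant {suc m} f eq (suc i) =
    ≡.trans (constant (f ∘ suc) (eq ∘ suc) i) (≡.sym (eq zero))

module TreeWalk {p : ℕ} {G : Graph p} (S : RootedSpanningTree G) where
  open Graph G
  open RootedSpanningTree S

  walk-to-root : ∀ x → Star _⌢_ x root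
  walk-to-root = depth-induction (λ x → Star _⌢_ x root) ε
    λ x x≢r w → inj₁ (x≢r , refl) ◅ w

  treeWalk : ∀ x y → Star _⌢_ x y
  treeWalk x y = walk-to-root x ◅◅ Star.reverse ⌢-sym (walk-to-root y)

  walk-parity : ∀ {x y} (w : Star _⌢_ x y) → colour x ≡ colour y → odd? (walkLength w) ≡ false
  walk-parity ε _ = refl
  walk-parity {x} {y} (_◅_ {j = z} s w) same = cong not (parity w z≢y)
    where
    flip : ∀ {x z} → x ⌢ z → colour x ≡ not (colour z)
    flip (inj₁ (x≢r , refl)) = colour-parent x≢r
    flip (inj₂ (z≢r , refl)) = not-injective
      (≡.trans (≡.sym (colour-parent z≢r)) (≡.sym (not-involutive _)))
    z≢y : colour z ≡ not (colour y)
    z≢y = ≡.trans (flip (⌢-sym s)) (cong not same)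
    parity : ∀ {z} (w : Star _⌢_ z y) → colour z ≡ not (colour y) → odd? (walkLength w) ≡ true
    parity ε eq = contradiction eq (not-¬ refl)
    parity (_◅_ {j = t} s w) eq = cong not (walk-parity w
      (≡.trans (flip (⌢-sym s)) (≡.trans (cong not eq) (not-involutive _))))

  avoiding-walk : ∀ {x s t} (w : Star _⌢_ s t) → ¬ x ∈ w ⊎ ¬ parent x ∈ w →
                  below x s ≡ below x t
  avoiding-walk ε _ = refl
  avoiding-walk {x} {s} (_◅_ {j = s′} r w) avoid with below x s ≟ᵇ below x s′
  ... | yes eq = ≡.trans eq (avoiding-walk w (Sum.map later later avoid))
    where
    later : ∀ {v} → ¬ v ∈ (r ◅ w) → ¬ v ∈ w
    later v∉ (i , eq) = v∉ (suc i , eq)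
  ... | no neq with crossing r neq | avoid
  ...   | inj₁ (refl , _)    | inj₁ x∉  = contradiction (zero , refl) x∉
  ...   | inj₁ (_ , refl)    | inj₂ px∉ = contradiction (suc zero , refl) px∉
  ...   | inj₂ (refl , _)    | inj₁ x∉  = contradiction (suc zero , refl) x∉
  ...   | inj₂ (_ , refl)    | inj₂ px∉ = contradiction (zero , refl) px∉

  between : ∀ {x s t v} (w : Star _⌢_ s t) → Simple w → v ∈ w →
            below x v ≡ below x s ⊎ below x v ≡ below x t
  between w s (zero , refl) = inj₁ refl
  between {x} {s} (_◅_ {j = s′} r w) (s∉w , simple) (suc i , eq)
    with between {x} w simple (i , eq) | below x s ≟ᵇ below x s′
  ... | inj₂ v≡t  | _      = inj₂ v≡t
  ... | inj₁ v≡s′ | yes s≡s′ = inj₁ (≡.trans v≡s′ (≡.sym s≡s′))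
  ... | inj₁ v≡s′ | no s≢s′ = inj₂ (≡.trans v≡s′ (avoiding-walk w avoid))
    where
    avoid : ¬ x ∈ w ⊎ ¬ parent x ∈ w
    avoid with crossing r s≢s′
    ... | inj₁ (refl , _) = inj₁ s∉w
    ... | inj₂ (_ , refl) = inj₂ s∉w

  record FundamentalCycle (e : Edge G) : Set where
    field
      cycle    : Cycle G
      odd      : Odd (Cycle.length cycle)
    open Cycle cycle public
    open Path arc public using (vertex; step)
    field
      start≡   : vertex zero ≡ Edge.lo e
      end≡     : vertex (fromℕ m) ≡ Edge.hi e
      treeStep : ∀ i → vertex (inject₁ i) ⌢ vertex (suc i)
      side     : ∀ x {v} → VertexOf v →
                 below x v ≡ below x (Edge.lo e) ⊎ below x v ≡ below x (Edge.hi e)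

    closing : Joins G e (vertex (fromℕ m)) (vertex zero)
    closing = inj₂ (≡.sym start≡ , ≡.sym end≡)

    crossingEdge : ∀ {x s t h} → VertexOf s → VertexOf t → below x s ≢ below x t →
                   Joins G h x (parent x) → EdgeOf h
    crossingEdge {x} {h = h} (i , refl) (j , refl) s≢t joins
      with k , cross ← crossing-index (below x ∘ vertex) i j s≢t
      with crossing (treeStep k) cross
    ... | inj₁ (eq , eq′) = inj₁ (k , subst₂ (Joins G h) (≡.sym eq) (≡.sym eq′) joins)
    ... | inj₂ (eq , eq′) =
      inj₁ (k , joins-sym {e = h} (subst₂ (Joins G h) (≡.sym eq) (≡.sym eq′) joins))

  fundamentalCycle : ∀ e → colour (Edge.lo e) ≡ colour (Edge.hi e) → FundamentalCycle e
  fundamentalCycle e mono with w , s ← loopErase (treeWalk (Edge.lo e) (Edge.hi e)) = record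
    { cycle    = record
      { arc    = toPath ⌢⇒∼ w s
      ; 2≤m    = 2≤length w (lo≢hi e) even
      ; closes = subst (_∼ Edge.lo e) (≡.sym (vertexAt-end w)) (∼-sym {G = G} (Edge.lo∼hi e))
      }
    ; odd      = odd?⇒Odd (cong not even)
    ; start≡   = refl
    ; end≡     = vertexAt-end w
    ; treeStep = vertexAt-step w
    ; side     = λ x → between {x} w s
    }
    where
    even = walk-parity w mono
    2≤length : ∀ {x y} (w : Star _⌢_ x y) → x ≢ y → odd? (walkLength w) ≡ false → 2 ℕ.≤ walkLength w
    2≤length ε           x≢x _  = contradiction refl x≢x
    2≤length (_ ◅ ε)     _   ()
    2≤length (_ ◅ _ ◅ _) _   _  = s≤s (s≤s z≤n)

module _ {p : ℕ} {G : Graph p} where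
  open Edge

  joins-ends : ∀ {P : Fin p → Set} {h x y} → Joins G h x y → P x → P y → P (lo h) × P (hi h)
  joins-ends (inj₁ (refl , refl)) Px Py = Px , Py
  joins-ends (inj₂ (refl , refl)) Px Py = Py , Px

  endpoint : ∀ {P : Fin p → Set} {h v w} → Joins G h v w → P (lo h) × P (hi h) → P v
  endpoint (inj₁ (refl , _)) = proj₁
  endpoint (inj₂ (_ , refl)) = proj₂

  path-ends : ∀ {m} (P : Path G m) h → Path.EdgeOf P h →
              Path.VertexOf P (lo h) × Path.VertexOf P (hi h)
  path-ends P h (i , j) =
    joins-ends {P = Path.VertexOf P} {h} j (inject₁ i , refl) (suc i , refl)

  cycle-ends : ∀ (C : Cycle G) h → Cycle.EdgeOf C h →
               Cycle.VertexOf C (lo h) × Cycle.VertexOf C (hi h)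
  cycle-ends C h (inj₁ arc)   = path-ends (Cycle.arc C) h arc
  cycle-ends C h (inj₂ close) =
    joins-ends {P = Cycle.VertexOf C} {h} close (fromℕ _ , refl) (zero , refl)

  onCycle? : ∀ (C : Cycle G) v → Dec (Cycle.VertexOf C v)
  onCycle? C v = any? λ i → Path.vertex (Cycle.arc C) i ≟ v

samePair-≢ : ∀ {a b c d} → a ≢ b → c ≢ d → SamePair a b c d
samePair-≢ {a} {b} {c} {d} a≢b c≢d with a ≟ᵇ c
... | yes refl = inj₁ (refl , not-injective (≡.trans (≡.sym (¬-not a≢b)) (¬-not c≢d)))
... | no  a≢c  = inj₂ (≡.trans (¬-not a≢c) (≡.sym (¬-not (c≢d ∘ ≡.sym))) ,
                       ≡.trans (¬-not (a≢b ∘ ≡.sym)) (≡.sym (¬-not (a≢c ∘ ≡.sym))))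

module PaddleConstruction {p : ℕ} {G : Graph p} (connected : Connected G)
  (S : RootedSpanningTree G) {e f : Edge G} (nontree : IsNontreePair S e f)
  (Zᵉ : TreeWalk.FundamentalCycle S e) (Zᶠ : TreeWalk.FundamentalCycle S f) where
  open Graph G
  open RootedSpanningTree S
  open IsNontreePair nontree
  open Edge
  open TreeWalk S

  private
    module C = FundamentalCycle Zᵉ
    module D = FundamentalCycle Zᶠ

    separated : ∀ {g} (Z : FundamentalCycle g) → let open FundamentalCycle Z in
                ∀ {x s t} → VertexOf s → VertexOf t → below x s ≢ below x t →
                below x (lo g) ≢ below x (hi g)
    separated {g} Z {x} s∈ t∈ s≢t lo≡hi = s≢t (≡.trans (toLo s∈) (≡.sym (toLo t∈)))
      where
      open FundamentalCycle Z
      toLo : ∀ {v} → VertexOf v → below x v ≡ below x (lo g)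
      toLo v∈ = [ id , (λ eq → ≡.trans eq (≡.sym lo≡hi)) ]′ (side x v∈)

  shared-unique : ∀ {s t} → C.VertexOf s × D.VertexOf s → C.VertexOf t × D.VertexOf t → s ≡ t
  shared-unique {s} {t} (s∈C , s∈D) (t∈C , t∈D) with s ≟ t
  ... | yes s≡t = s≡t
  ... | no  s≢t with x , x≢r , cross ← separator s≢t = contradiction
    (samePair-≢ (separated Zᵉ {x} s∈C t∈C cross)
                (separated Zᶠ {x} s∈D t∈D cross))
    (cut x x≢r)

  edgeDisjoint : EdgeDisjoint G C.cycle D.cycle
  edgeDisjoint h (h∈C , h∈D)
    with lo∈C , hi∈C ← cycle-ends C.cycle h h∈C | lo∈D , hi∈D ← cycle-ends D.cycle h h∈D =
    lo≢hi h (shared-unique (lo∈C , lo∈D) (hi∈C , hi∈D))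

  tree-joins : ∀ h → TreeEdge h → ∃[ x ] x ≢ root × Joins G h x (parent x)
  tree-joins h (inj₁ (lo≢r , hi≡)) = lo h , lo≢r , inj₁ (refl , hi≡)
  tree-joins h (inj₂ (hi≢r , lo≡)) = hi h , hi≢r , inj₂ (lo≡ , refl)

  edges-covered : (K : Edge G → Set) → ∀ {s t} → C.VertexOf s → D.VertexOf t →
    (∀ {x h} → Joins G h x (parent x) →
      below x (lo e) ≡ below x (hi e) → below x (lo f) ≡ below x (hi f) →
      below x s ≢ below x t → K h) →
    ∀ h → C.EdgeOf h ⊎ D.EdgeOf h ⊎ K h
  edges-covered K {s} {t} s∈C t∈D link h with lo h ⌢? hi h
  ... | no nt with nontree-only h nt
  ...   | inj₁ refl = inj₁ (inj₂ C.closing)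
  ...   | inj₂ refl = inj₂ (inj₁ (inj₂ D.closing))
  edges-covered K {s} {t} s∈C t∈D link h | yes tree
    with x , x≢r , j ← tree-joins h tree
    with below x (lo e) ≟ᵇ below x (hi e) | below x (lo f) ≟ᵇ below x (hi f)
       | below x (lo e) ≟ᵇ below x s | below x (lo f) ≟ᵇ below x t
  ... | no e-cross | _ | _ | _ =
    inj₁ (C.crossingEdge {x} {h = h} (zero , C.start≡) (fromℕ _ , C.end≡) e-cross j)
  ... | yes _ | no f-cross | _ | _ =
    inj₂ (inj₁ (D.crossingEdge {x} {h = h} (zero , D.start≡) (fromℕ _ , D.end≡) f-cross j))
  ... | yes _ | yes _ | no cross | _ =
    inj₁ (C.crossingEdge {x} {h = h} (zero , C.start≡) s∈C cross j)
  ... | yes _ | yes _ | yes _ | no cross =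
    inj₂ (inj₁ (D.crossingEdge {x} {h = h} (zero , D.start≡) t∈D cross j))
  ... | yes e≡ | yes f≡ | yes es | yes ft = inj₂ (inj₂ (link {x} {h} j e≡ f≡ λ s≡t →
          let ef = ≡.trans es (≡.trans s≡t (≡.sym ft)) in
          cut x x≢r (inj₁ (ef , ≡.trans (≡.sym e≡) (≡.trans ef f≡)))))

  incident-edge : ∀ v → ∃₂ λ h w → Joins G h v w
  incident-edge v with v ≟ lo e
  ... | yes refl = e , hi e , joins-self e
  ... | no v≢lo with connected v (lo e)
  ...   | ε       = contradiction refl v≢lo
  ...   | v∼w ◅ _ with h , j ← ∼⇒edge {G = G} v∼w = h , _ , j

  touchingUnion : ∀ {s} → C.VertexOf s → D.VertexOf s → TouchingUnion G C.cycle D.cycle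
  touchingUnion {s} s∈C s∈D =
      (s , (s∈C , s∈D) , shared-unique (s∈C , s∈D))
    , vertices
    , edges
    where
    edges : ∀ h → C.EdgeOf h ⊎ D.EdgeOf h
    edges h with edges-covered (λ _ → ⊥) s∈C s∈D (λ _ _ _ s≢s → s≢s refl) h
    ... | inj₁ h∈C        = inj₁ h∈C
    ... | inj₂ (inj₁ h∈D) = inj₂ h∈D
    vertices : ∀ v → C.VertexOf v ⊎ D.VertexOf v
    vertices v with h , _ , j ← incident-edge v =
      Sum.map (endpoint {P = C.VertexOf} {h} j ∘ cycle-ends C.cycle h)
              (endpoint {P = D.VertexOf} {h} j ∘ cycle-ends D.cycle h) (edges h)

  joinedUnion : Connector {R = _∼_} C.VertexOf D.VertexOf →
                (∀ v → ¬ (C.VertexOf v × D.VertexOf v)) → JoinedUnion G C.cycle D.cycle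
  joinedUnion Y disjoint = disjoint , _ , P
    , record
      { start∈C  = start∈P
      ; end∈D    = subst D.VertexOf (≡.sym (vertexAt-end walk)) end∈Q
      ; internal = λ { x (i , i≢0 , i≢end , refl) → internal i i≢0 i≢end }
      }
    , vertices
    , edges
    where
    open Connector Y
    P = toPath id walk simple
    link : ∀ {x h} → Joins G h x (parent x) →
      below x (lo e) ≡ below x (hi e) → below x (lo f) ≡ below x (hi f) →
      below x start ≢ below x end → Path.EdgeOf P h
    link {x} {h} j e≡ f≡ cross
      with k , crossₖ ← crossing-index (below x ∘ Path.vertex P) zero (fromℕ _)
                          (λ eq → cross (≡.trans eq (cong (below x) (vertexAt-end walk))))
      with g , jᵍ ← ∼⇒edge {G = G} (Path.step P k) = k , byTree (lo g ⌢? hi g)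
      where
      y z : Fin p
      y = Path.vertex P (inject₁ k)
      z = Path.vertex P (suc k)
      sameSide : ∀ {g} → below x (lo g) ≡ below x (hi g) → Joins G g y z → below x y ≡ below x z
      sameSide eq (inj₁ (refl , refl)) = eq
      sameSide eq (inj₂ (refl , refl)) = ≡.sym eq
      byTree : Dec (TreeEdge g) → Joins G h y z
      byTree (yes tree) with crossing (joins⇒⌢ {g} tree jᵍ) crossₖ
      ... | inj₁ (eq , eq′) = subst₂ (Joins G h) (≡.sym eq) (≡.sym eq′) j
      ... | inj₂ (eq , eq′) = joins-sym {e = h} (subst₂ (Joins G h) (≡.sym eq) (≡.sym eq′) j)
      byTree (no nt) with nontree-only g nt
      ... | inj₁ refl = contradiction (sameSide {e} e≡ jᵍ) crossₖ
      ... | inj₂ refl = contradiction (sameSide {f} f≡ jᵍ) crossₖ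
    edges : ∀ h → C.EdgeOf h ⊎ D.EdgeOf h ⊎ Path.EdgeOf P h
    edges = edges-covered (Path.EdgeOf P) start∈P end∈Q (λ {x} {h} → link {x} {h})
    vertices : ∀ v → C.VertexOf v ⊎ D.VertexOf v ⊎ Path.VertexOf P v
    vertices v with h , _ , j ← incident-edge v =
      Sum.map (endpoint {P = C.VertexOf} {h} j ∘ cycle-ends C.cycle h)
        (Sum.map (endpoint {P = D.VertexOf} {h} j ∘ cycle-ends D.cycle h)
                 (endpoint {P = Path.VertexOf P} {h} j ∘ path-ends P h)) (edges h)

  isDoublyOddPaddle : IsDoublyOddPaddle G
  isDoublyOddPaddle = C.cycle , D.cycle , C.odd , D.odd , edgeDisjoint , union
    where
    union : TouchingUnion G C.cycle D.cycle ⊎ JoinedUnion G C.cycle D.cycle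
    union with any? (λ v → onCycle? C.cycle v ×-dec onCycle? D.cycle v)
    ... | yes (s , s∈C , s∈D) = inj₁ (touchingUnion s∈C s∈D)
    ... | no none = inj₂ (joinedUnion
          (connector (onCycle? C.cycle) (onCycle? D.cycle) (proj₁ erased) (proj₂ erased)
            (zero , zero , C.start≡) (zero , D.start≡))
          (λ v both → none (v , both)))
      where erased = loopErase (connected (lo e) (lo f))

Odd⇒odd? : ∀ {n} → Odd n → odd? n ≡ true
Odd⇒odd? {n} odd with odd? n in eq
... | true  = refl
... | false = contradiction (even⇒2∣ n eq) odd
  where
  even⇒2∣ : ∀ n → odd? n ≡ false → 2 ∣ n
  even⇒2∣ zero          _  = divides 0 refl
  even⇒2∣ (suc (suc n)) eq with divides q n≡ ← even⇒2∣ n (not-injective (not-injective eq)) =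
    divides (suc q) (cong (λ k → suc (suc k)) n≡)

xor-cancelʳ : ∀ a b c → a xor c ≡ b xor c → a ≡ b
xor-cancelʳ true  true  _     _ = refl
xor-cancelʳ true  false true  ()
xor-cancelʳ true  false false ()
xor-cancelʳ false true  true  ()
xor-cancelʳ false true  false ()
xor-cancelʳ false false _     _ = refl

upTo : ∀ {m} → Fin m → Fin (suc m) → Bool
upTo i j = does (toℕ j ℕₚ.≤? toℕ i)

upTo-step : ∀ {m} {i j : Fin m} → j ≢ i → upTo i (inject₁ j) ≡ upTo i (suc j)
upTo-step {m} {i} {j} j≢i rewrite toℕ-inject₁ j = step (toℕ j ℕₚ.≤? toℕ i)
  where
  step : (j≤?i : Dec (toℕ j ℕ.≤ toℕ i)) → does j≤?i ≡ upTo i (suc j)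
  step (yes j≤i) = ≡.sym (dec-true (suc (toℕ j) ℕₚ.≤? toℕ i) (ℕₚ.≤∧≢⇒< j≤i (j≢i ∘ toℕ-injective)))
  step (no  j≰i) = ≡.sym (dec-false (suc (toℕ j) ℕₚ.≤? toℕ i) (j≰i ∘ ℕₚ.<⇒≤))

upTo-zero : ∀ {m} (i : Fin m) → upTo i zero ≡ true
upTo-zero i = dec-true (0 ℕₚ.≤? toℕ i) z≤n

upTo-self : ∀ {m} (i : Fin m) → upTo i (inject₁ i) ≡ true
upTo-self i = dec-true (toℕ (inject₁ i) ℕₚ.≤? toℕ i) (ℕₚ.≤-reflexive (toℕ-inject₁ i))

upTo-suc : ∀ {m} (i : Fin m) → upTo i (suc i) ≡ false
upTo-suc i = dec-false (suc (toℕ i) ℕₚ.≤? toℕ i) ℕₚ.1+n≰n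

upTo-last : ∀ {m} (i : Fin m) → upTo i (fromℕ m) ≡ false
upTo-last {m} i = dec-false (toℕ (fromℕ m) ℕₚ.≤? toℕ i)
  λ m≤i → ℕₚ.<-irrefl refl (ℕₚ.≤-trans (toℕ<n i) (subst (ℕ._≤ toℕ i) (toℕ-fromℕ m) m≤i))

parity : ∀ {m} → Fin m → Bool
parity j = odd? (toℕ j)

parity-step : ∀ {m} (j : Fin m) → parity (suc j) ≡ not (parity (inject₁ j))
parity-step j rewrite toℕ-inject₁ j = refl

module _ {p : ℕ} {G : Graph p} where
  open Edge

  onPath? : ∀ {m} (P : Path G m) v → Dec (Path.VertexOf P v)
  onPath? P v = any? λ i → Path.vertex P i ≟ v

  labelled : ∀ {m} (P : Path G m) → (Fin (suc m) → Bool) → Fin p → Bool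
  labelled P g v with onPath? P v
  ... | yes (i , _) = g i
  ... | no  _       = false

  labelled-on : ∀ {m} (P : Path G m) g j → labelled P g (Path.vertex P j) ≡ g j
  labelled-on P g j with onPath? P (Path.vertex P j)
  ... | yes (i , eq) = cong g (Path.injective P eq)
  ... | no  ∉P       = contradiction (j , refl) ∉P

  labelled-off : ∀ {m} (P : Path G m) g {v} → ¬ Path.VertexOf P v → labelled P g v ≡ false
  labelled-off P g {v} v∉P with onPath? P v
  ... | yes v∈P = contradiction v∈P v∉P
  ... | no  _   = refl

  cycleEdge? : (C : Cycle G) → ∀ h → Dec (Cycle.EdgeOf C h)
  cycleEdge? C h = any? (λ i → joins? G h (vertex (inject₁ i)) (vertex (suc i)))
             ⊎-dec joins? G h (vertex (fromℕ _)) (vertex zero)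
    where open Path (Cycle.arc C)

module Links {c ℓ₁ ℓ₂} (F : HeytingField c ℓ₁ ℓ₂) (2#0 : CharacteristicNot2 F)
  {p : ℕ} (G : Graph p) where
  open HeytingField F hiding (zero) renaming (refl to ≈-refl; reflexive to ≈-reflexive)
  open HeytingCommutativeRing heytingCommutativeRing using (commutativeRing)
  open CommutativeRing commutativeRing using (ring; +-commutativeMonoid)
  open CommutativeSemigroupProperties
    (CommutativeMonoid.commutativeSemigroup +-commutativeMonoid) using (interchange)
  open RingProperties ring using (-‿distribˡ-*)
  open NormalGraphAlgebra F G
  open HeytingFieldProperties F
  open SquareSupport F G
  open Edge
  open import Relation.Binary.Reasoning.Setoid setoid

  Linked : Edge G → Edge G → Set (c ⊔ ℓ₁ ⊔ ℓ₂)
  Linked e f = e ≡ f ⊎ ∃[ u ] SupportedOnPair u e f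

  linked-sym : ∀ {e f} → Linked e f → Linked f e
  linked-sym (inj₁ e≡f)     = inj₁ (≡.sym e≡f)
  linked-sym (inj₂ (u , s)) = inj₂ (u , record
    { first#0 = second#0 ; second#0 = first#0 ; others≈0 = λ h h≢f h≢e → others≈0 h h≢e h≢f })
    where open SupportedOnPair s

  edgeValue-linear : ∀ a b u v h → edgeValue (λ x → a * u x + b * v x) h ≈
                     a * edgeValue u h + b * edgeValue v h
  edgeValue-linear a b u v h = trans (interchange _ _ _ _)
    (sym (+-cong (distribˡ a _ _) (distribˡ b _ _)))

  linked-trans : ∀ {e f g} → Linked e f → Linked f g → Linked e g
  linked-trans (inj₁ refl) f~g = f~g
  linked-trans e~f@(inj₂ _) (inj₁ refl) = e~f
  linked-trans {e} {f} {g} (inj₂ (u , s)) (inj₂ (v , t)) with e ≟ᴱ g | e ≟ᴱ f | f ≟ᴱ g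
  ... | yes e≡g | _        | _        = inj₁ e≡g
  ... | no _    | yes refl | _        = inj₂ (v , t)
  ... | no _    | no _     | yes refl = inj₂ (u , s)
  ... | no e≢g  | no e≢f   | no f≢g   = inj₂ (w , record
    { first#0  = #-congʳ (sym (trans (edgeValue-linear b′ (- b) u v e)
        (trans (+-congˡ (trans (*-congˡ (T.others≈0 e e≢f e≢g)) (zeroʳ _))) (+-identityʳ _))))
        (x#0y#0→xy#0 T.first#0 S.first#0)
    ; second#0 = #-congʳ (sym (trans (edgeValue-linear b′ (- b) u v g)
        (trans (+-congʳ (trans (*-congˡ (S.others≈0 g (e≢g ∘ ≡.sym) (f≢g ∘ ≡.sym))) (zeroʳ _)))
          (+-identityˡ _))))
        (x#0y#0→xy#0 (-x#0 S.second#0) T.second#0)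
    ; others≈0 = others
    })
    where
    module S = SupportedOnPair s
    module T = SupportedOnPair t
    b b′ : Carrier
    b  = edgeValue u f
    b′ = edgeValue v f
    w : U
    w x = b′ * u x + - b * v x
    others : ∀ h → h ≢ e → h ≢ g → edgeValue w h ≈ 0#
    others h h≢e h≢g with h ≟ᴱ f
    ... | yes refl = begin
      edgeValue w f      ≈⟨ edgeValue-linear b′ (- b) u v f ⟩
      b′ * b + - b * b′  ≈⟨ +-cong (*-comm b′ b) (sym (-‿distribˡ-* b b′)) ⟩
      b * b′ - b * b′    ≈⟨ -‿inverseʳ _ ⟩
      0#                 ∎
    ... | no h≢f = begin
      edgeValue w h      ≈⟨ edgeValue-linear b′ (- b) u v h ⟩
      b′ * edgeValue u h + - b * edgeValue v h
        ≈⟨ +-cong (*-congˡ (S.others≈0 h h≢e h≢f)) (*-congˡ (T.others≈0 h h≢f h≢g)) ⟩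
      b′ * 0# + - b * 0# ≈⟨ +-cong (zeroʳ _) (zeroʳ _) ⟩
      0# + 0#            ≈⟨ +-identityʳ _ ⟩
      0#                 ∎

  masked : (region colour : Fin p → Bool) → U
  masked region colour x = if region x then sgn (colour x) else 0#

  module _ (region colour : Fin p → Bool) {h x y} (j : Joins G h x y) where
    private
      u : U
      u = masked region colour

      value : ∀ {r s} → region x ≡ r → region y ≡ s →
              edgeValue u h ≈ (if r then sgn (colour x) else 0#) + (if s then sgn (colour y) else 0#)
      value refl refl = edgeValue-joins u {h} j

    masked-outside : region x ≡ false → region y ≡ false → edgeValue u h ≈ 0#
    masked-outside x∉ y∉ = trans (value x∉ y∉) (+-identityʳ _)

    masked-proper : region x ≡ region y → colour y ≡ not (colour x) → edgeValue u h ≈ 0#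
    masked-proper same flip = byRegion (region x) refl
      where
      byRegion : ∀ r → region x ≡ r → edgeValue u h ≈ 0#
      byRegion false x∉ = masked-outside x∉ (≡.trans (≡.sym same) x∉)
      byRegion true  x∈ = trans (value x∈ (≡.trans (≡.sym same) x∈))
        (trans (+-congˡ (≈-reflexive (cong sgn flip))) (sgn+sgn-not (colour x)))

    masked-boundary : region x ≢ region y → edgeValue u h # 0#
    masked-boundary differ = byRegion (region x) (region y) refl refl
      where
      byRegion : ∀ r s → region x ≡ r → region y ≡ s → edgeValue u h # 0#
      byRegion false false x∉ y∉ = contradiction (≡.trans x∉ (≡.sym y∉)) differ
      byRegion true  true  x∈ y∈ = contradiction (≡.trans x∈ (≡.sym y∈)) differ
      byRegion true  false x∈ y∉ = #-congʳ (sym (trans (value x∈ y∉) (+-identityʳ _))) (sgn#0 (colour x))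
      byRegion false true  x∉ y∈ = #-congʳ (sym (trans (value x∉ y∈) (+-identityˡ _))) (sgn#0 (colour y))

    masked-monochromatic : region x ≡ true → region y ≡ true → colour x ≡ colour y →
                           edgeValue u h # 0#
    masked-monochromatic x∈ y∈ same = #-congʳ (sym (begin
      edgeValue u h                             ≈⟨ value x∈ y∈ ⟩
      sgn (colour x) + sgn (colour y)           ≡⟨ cong (λ b → sgn (colour x) + sgn b) same ⟨
      sgn (colour x) + sgn (colour x)           ≈⟨ +-cong (*-identityˡ _) (*-identityˡ _) ⟨
      1# * sgn (colour x) + 1# * sgn (colour x) ≈⟨ distribʳ _ _ _ ⟨
      (1# + 1#) * sgn (colour x)                ∎)) (x#0y#0→xy#0 2#0 (sgn#0 (colour x)))

  -- Deleting an arc edge and the closing edge leaves two segments of C; alternate on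
  -- the one that avoids the attachment vertex.

  cycle-linked : (C : Cycle G) → let open Cycle C in
    (k : Fin (suc m)) →
    (∀ {h v w} → Joins G h v w → VertexOf v → ¬ EdgeOf h → v ≡ Path.vertex arc k) →
    ∀ {h h₀} → EdgeOf h → Joins G h₀ (Path.end arc) (Path.start arc) → Linked h h₀
  cycle-linked C k attach {h} {h₀} (inj₂ j) j₀ = inj₁ (joins-unique {e = h} {h₀} j j₀)
  cycle-linked C k attach {h} {h₀} (inj₁ (i , j)) j₀ = inj₂ (masked region colour , record
    { first#0  = masked-boundary region colour {h} j (≢-region {inject₁ i} {suc i}
        λ eq → contradiction (≡.trans (≡.sym (upTo-self i)) (≡.trans eq (upTo-suc i))) λ ())
    ; second#0 = masked-boundary region colour {h₀} j₀ (≢-region {fromℕ m} {zero}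
        λ eq → contradiction (≡.trans (≡.sym (upTo-zero i)) (≡.trans (≡.sym eq) (upTo-last i))) λ ())
    ; others≈0 = others
    })
    where
    open Cycle C
    open Path arc using (vertex)
    side : Fin (suc m) → Bool
    side l = upTo i l xor upTo i k
    region colour : Fin p → Bool
    region = labelled arc side
    colour = labelled arc parity
    region-on : ∀ l → region (vertex l) ≡ side l
    region-on = labelled-on arc side
    ≢-region : ∀ {l l′} → upTo i l ≢ upTo i l′ → region (vertex l) ≢ region (vertex l′)
    ≢-region {l} {l′} differ eq = differ (xor-cancelʳ (upTo i l) (upTo i l′) (upTo i k)
      (≡.trans (≡.sym (region-on l)) (≡.trans eq (region-on l′))))
    others : ∀ g → g ≢ h → g ≢ h₀ → edgeValue (masked region colour) g ≈ 0#
    others g g≢h g≢h₀ = byEdge (cycleEdge? C g)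
      where
      outside : ¬ EdgeOf g → ∀ {v w} → Joins G g v w → region v ≡ false
      outside g∉C {v} j′ = byVertex (onCycle? C v)
        where
        byVertex : Dec (VertexOf v) → region v ≡ false
        byVertex (no  v∉C) = labelled-off arc side v∉C
        byVertex (yes v∈C) = ≡.trans (cong region (attach {g} j′ v∈C g∉C))
          (≡.trans (region-on k) (xor-same (upTo i k)))
      byEdge : Dec (EdgeOf g) → edgeValue (masked region colour) g ≈ 0#
      byEdge (yes (inj₂ j′)) = contradiction (joins-unique {e = g} {h₀} j′ j₀) g≢h₀
      byEdge (yes (inj₁ (l , j′))) = masked-proper region colour {g} j′
        (≡.trans (region-on (inject₁ l))
          (≡.trans (cong (_xor upTo i k) (upTo-step {i = i} {l}
              λ { refl → g≢h (joins-unique {e = g} {h} j′ j) }))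
            (≡.sym (region-on (suc l)))))
        (≡.trans (labelled-on arc parity (suc l)) (≡.trans (parity-step l)
          (cong not (≡.sym (labelled-on arc parity (inject₁ l))))))
      byEdge (no g∉C) = masked-outside region colour {g} (joins-self g)
        (outside g∉C (joins-self g)) (outside g∉C (joins-sym {e = g} (joins-self g)))

record PaddleParts {p : ℕ} (G : Graph p) : Set where
  field
    C D   : Cycle G
    oddᶜ  : Odd (Cycle.length C)
    oddᴰ  : Odd (Cycle.length D)
    {n}   : ℕ
    P     : Path G n
  module C = Cycle C
  module D = Cycle D
  module P = Path P
  field
    start∈C : C.VertexOf P.start
    end∈D   : D.VertexOf P.end
    C∩D     : ∀ {v} → C.VertexOf v → D.VertexOf v → v ≡ P.start × v ≡ P.end
    C∩P     : ∀ {j} → C.VertexOf (P.vertex j) → j ≡ zero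
    P∩D     : ∀ {j} → D.VertexOf (P.vertex j) → j ≡ fromℕ n
    covers  : ∀ h → C.EdgeOf h ⊎ D.EdgeOf h ⊎ P.EdgeOf h

-- Two touching cycles are joined by a path without edges.

paddleParts : ∀ {p} {G : Graph p} → IsDoublyOddPaddle G → PaddleParts G
paddleParts (C , D , oddᶜ , oddᴰ , _ , inj₁ ((v , (v∈C , v∈D) , unique) , _ , edges)) = record
  { C = C ; D = D ; oddᶜ = oddᶜ ; oddᴰ = oddᴰ
  ; n = 0 ; P = record { vertex = λ _ → v ; injective = λ { {zero} {zero} _ → refl } ; step = λ () }
  ; start∈C = v∈C ; end∈D = v∈D
  ; C∩D = λ x∈C x∈D → ≡.sym (unique (x∈C , x∈D)) , ≡.sym (unique (x∈C , x∈D))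
  ; C∩P = λ { {zero} _ → refl } ; P∩D = λ { {zero} _ → refl }
  ; covers = λ h → Sum.map₂ inj₁ (edges h)
  }
paddleParts {G = G} (C , D , oddᶜ , oddᴰ , _ , inj₂ (disjoint , n , P , joined , _ , edges)) = record
  { C = C ; D = D ; oddᶜ = oddᶜ ; oddᴰ = oddᴰ ; P = P
  ; start∈C = start∈C ; end∈D = end∈D
  ; C∩D = λ x∈C x∈D → contradiction (x∈C , x∈D) (disjoint _)
  ; C∩P = λ {j} → onC j ; P∩D = λ {j} → onD j ; covers = edges
  }
  where
  open JoinedBy joined
  onC : ∀ j → Cycle.VertexOf C (Path.vertex P j) → j ≡ zero
  onC j ∈C with j ≟ zero | j ≟ fromℕ n
  ... | yes j≡0 | _        = j≡0
  ... | no _    | yes refl = contradiction (∈C , end∈D) (disjoint _)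
  ... | no j≢0  | no j≢n   = contradiction ∈C (proj₁ (internal _ (j , j≢0 , j≢n , refl)))
  onD : ∀ j → Cycle.VertexOf D (Path.vertex P j) → j ≡ fromℕ n
  onD j ∈D with j ≟ zero | j ≟ fromℕ n
  ... | _        | yes j≡n = j≡n
  ... | yes refl | no _    = contradiction (start∈C , ∈D) (disjoint _)
  ... | no j≢0   | no j≢n  = contradiction ∈D (proj₂ (internal _ (j , j≢0 , j≢n , refl)))

-- The colouring alternates along the spanning tree left when the closing edges of C
-- and D are deleted, and is normalised to false at the start of P.

module PaddleColouring {p : ℕ} {G : Graph p} (parts : PaddleParts G) where
  open PaddleParts parts

  k : Fin (suc C.m)
  k = proj₁ start∈C

  l : Fin (suc D.m)
  l = proj₁ end∈D

  labelᶜ : Fin (suc C.m) → Bool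
  labelᶜ j = parity j xor parity k

  labelᴰ : Fin (suc D.m) → Bool
  labelᴰ j = parity j xor (parity l xor parity (fromℕ n))

  private
    colourBy : ∀ v → Dec (C.VertexOf v) → Dec (P.VertexOf v) → Bool
    colourBy v (yes _) _       = labelled C.arc labelᶜ v
    colourBy v (no  _) (yes _) = labelled P parity v
    colourBy v (no  _) (no  _) = labelled D.arc labelᴰ v

  colour : Fin p → Bool
  colour v = colourBy v (onCycle? C v) (onPath? P v)

  private
    labelᶜ-start : labelled C.arc labelᶜ P.start ≡ false
    labelᶜ-start = ≡.trans (cong (labelled C.arc labelᶜ) (≡.sym (proj₂ start∈C)))
      (≡.trans (labelled-on C.arc labelᶜ k) (xor-same (parity k)))

    xor-xor : ∀ a b → a xor (a xor b) ≡ b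
    xor-xor true  true  = refl
    xor-xor true  false = refl
    xor-xor false _     = refl

    labelᴰ-end : ∀ {j} → Path.vertex D.arc j ≡ P.end → labelᴰ j ≡ parity (fromℕ n)
    labelᴰ-end eq = ≡.trans (cong labelᴰ (Path.injective D.arc (≡.trans eq (≡.sym (proj₂ end∈D)))))
      (xor-xor (parity l) _)

  colourᶜ : ∀ j → colour (Path.vertex C.arc j) ≡ labelᶜ j
  colourᶜ j = by (onCycle? C _) (onPath? P _)
    where
    by : ∀ d₁ d₂ → colourBy (Path.vertex C.arc j) d₁ d₂ ≡ labelᶜ j
    by (yes _) _ = labelled-on C.arc labelᶜ j
    by (no ∉C) _ = contradiction (j , refl) ∉C

  colourᴾ : ∀ j → colour (P.vertex j) ≡ parity j
  colourᴾ j = by (onCycle? C _) (onPath? P _)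
    where
    by : ∀ d₁ d₂ → colourBy (P.vertex j) d₁ d₂ ≡ parity j
    by (yes ∈C) _ = atStart (C∩P ∈C)
      where
      atStart : ∀ {j} → j ≡ zero → labelled C.arc labelᶜ (P.vertex j) ≡ parity j
      atStart refl = labelᶜ-start
    by (no _) (yes _) = labelled-on P parity j
    by (no _) (no ∉P) = contradiction (j , refl) ∉P

  colourᴰ : ∀ j → colour (Path.vertex D.arc j) ≡ labelᴰ j
  colourᴰ j = by (onCycle? C _) (onPath? P _)
    where
    by : ∀ d₁ d₂ → colourBy (Path.vertex D.arc j) d₁ d₂ ≡ labelᴰ j
    by (yes ∈C) _ with ≡start , ≡end ← C∩D ∈C (j , refl) =
      ≡.trans (cong (labelled C.arc labelᶜ) ≡start) (≡.trans labelᶜ-start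
        (≡.trans (cong parity (P.injective (≡.trans (≡.sym ≡start) ≡end))) (≡.sym (labelᴰ-end ≡end))))
    by (no _) (yes (i , eq)) = ≡.trans (cong (labelled P parity) ≡end)
      (≡.trans (labelled-on P parity (fromℕ n)) (≡.sym (labelᴰ-end ≡end)))
      where
      ≡end : Path.vertex D.arc j ≡ P.end
      ≡end = ≡.trans (≡.sym eq) (cong P.vertex (P∩D (j , ≡.sym eq)))
    by (no _) (no _) = labelled-on D.arc labelᴰ j

  private
    shifted-step : ∀ {m} (j : Fin m) b → parity (suc j) xor b ≡ not (parity (inject₁ j) xor b)
    shifted-step j b = ≡.trans (cong (_xor b) (parity-step j))
      (≡.sym (not-distribˡ-xor (parity (inject₁ j)) b))

    shifted-closing : ∀ {m} b → Odd (suc m) → parity (fromℕ m) xor b ≡ b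
    shifted-closing {m} b odd = cong (_xor b)
      (≡.trans (cong odd? (toℕ-fromℕ m)) (not-injective (Odd⇒odd? odd)))

  properᶜ : ∀ j → colour (Path.vertex C.arc (suc j)) ≡ not (colour (Path.vertex C.arc (inject₁ j)))
  properᶜ j = ≡.trans (colourᶜ (suc j))
    (≡.trans (shifted-step j _) (cong not (≡.sym (colourᶜ (inject₁ j)))))

  properᴰ : ∀ j → colour (Path.vertex D.arc (suc j)) ≡ not (colour (Path.vertex D.arc (inject₁ j)))
  properᴰ j = ≡.trans (colourᴰ (suc j))
    (≡.trans (shifted-step j _) (cong not (≡.sym (colourᴰ (inject₁ j)))))

  properᴾ : ∀ j → colour (P.vertex (suc j)) ≡ not (colour (P.vertex (inject₁ j)))
  properᴾ j = ≡.trans (colourᴾ (suc j))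
    (≡.trans (parity-step j) (cong not (≡.sym (colourᴾ (inject₁ j)))))

  closingᶜ : colour (Path.end C.arc) ≡ colour (Path.start C.arc)
  closingᶜ = ≡.trans (colourᶜ (fromℕ C.m)) (≡.trans (shifted-closing _ oddᶜ) (≡.sym (colourᶜ zero)))

  closingᴰ : colour (Path.end D.arc) ≡ colour (Path.start D.arc)
  closingᴰ = ≡.trans (colourᴰ (fromℕ D.m)) (≡.trans (shifted-closing _ oddᴰ) (≡.sym (colourᴰ zero)))

  attachᶜ : ∀ {h v w} → Joins G h v w → C.VertexOf v → ¬ C.EdgeOf h → v ≡ Path.vertex C.arc k
  attachᶜ {h} {v} j v∈C h∉C with covers h
  ... | inj₁ h∈C = contradiction h∈C h∉C
  ... | inj₂ (inj₁ h∈D) = ≡.trans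
    (proj₁ (C∩D v∈C (endpoint {P = D.VertexOf} {h} j (cycle-ends D h h∈D)))) (≡.sym (proj₂ start∈C))
  ... | inj₂ (inj₂ h∈P) with i , refl ← endpoint {P = P.VertexOf} {h} j (path-ends P h h∈P) =
    ≡.trans (cong P.vertex (C∩P v∈C)) (≡.sym (proj₂ start∈C))

  attachᴰ : ∀ {h v w} → Joins G h v w → D.VertexOf v → ¬ D.EdgeOf h → v ≡ Path.vertex D.arc l
  attachᴰ {h} {v} j v∈D h∉D with covers h
  ... | inj₂ (inj₁ h∈D) = contradiction h∈D h∉D
  ... | inj₁ h∈C = ≡.trans
    (proj₂ (C∩D (endpoint {P = C.VertexOf} {h} j (cycle-ends C h h∈C)) v∈D)) (≡.sym (proj₂ end∈D))
  ... | inj₂ (inj₂ h∈P) with i , refl ← endpoint {P = P.VertexOf} {h} j (path-ends P h h∈P) =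
    ≡.trans (cong P.vertex (P∩D v∈D)) (≡.sym (proj₂ end∈D))

  module Beyond (i : Fin n) where

    near : Fin p → Bool
    near v = does (onCycle? C v) ∨ labelled P (upTo i) v

    nearᶜ : ∀ {v} → C.VertexOf v → near v ≡ true
    nearᶜ {v} v∈C = cong (_∨ labelled P (upTo i) v) (dec-true (onCycle? C v) v∈C)

    private
      off-C : ∀ {v} → ¬ C.VertexOf v → near v ≡ labelled P (upTo i) v
      off-C {v} v∉C = cong (_∨ labelled P (upTo i) v) (dec-false (onCycle? C v) v∉C)

    nearᴾ : ∀ j → near (P.vertex j) ≡ upTo i j
    nearᴾ j = by (onCycle? C (P.vertex j))
      where
      by : Dec (C.VertexOf (P.vertex j)) → near (P.vertex j) ≡ upTo i j
      by (yes ∈C) = ≡.trans (nearᶜ ∈C) (≡.sym (≡.trans (cong (upTo i) (C∩P ∈C)) (upTo-zero i)))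
      by (no  ∉C) = ≡.trans (off-C ∉C) (labelled-on P (upTo i) j)

    nearᴰ : ∀ {v} → D.VertexOf v → near v ≡ false
    nearᴰ {v} v∈D = by (onPath? P v)
      where
      by : Dec (P.VertexOf v) → near v ≡ false
      by (yes (j , refl)) = ≡.trans (nearᴾ j) (≡.trans (cong (upTo i) (P∩D v∈D)) (upTo-last i))
      by (no  v∉P) = ≡.trans (off-C v∉C) (labelled-off P (upTo i) v∉P)
        where
        v∉C : ¬ C.VertexOf v
        v∉C v∈C = v∉P (zero , ≡.sym (proj₁ (C∩D v∈C v∈D)))

module PaddleSupports {c ℓ₁ ℓ₂} (F : HeytingField c ℓ₁ ℓ₂) (2#0 : CharacteristicNot2 F)
  {p : ℕ} {G : Graph p} (parts : PaddleParts G) where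
  open HeytingField F using (_≈_; 0#)
  open NormalGraphAlgebra F G using (EveryEdgePairIsSupportOfSquare)
  open SquareSupport F G
  open Links F 2#0 G
  open PaddleParts parts
  open PaddleColouring parts

  private
    closeᶜ = ∼⇒edge {G = G} C.closes
    closeᴰ = ∼⇒edge {G = G} D.closes
    e₀ = proj₁ closeᶜ
    f₀ = proj₁ closeᴰ

    everywhere : Fin p → Bool
    everywhere _ = true

  closing-linked : Linked f₀ e₀
  closing-linked = inj₂ (masked everywhere colour , record
    { first#0  = masked-monochromatic everywhere colour {f₀} (proj₂ closeᴰ) refl refl closingᴰ
    ; second#0 = masked-monochromatic everywhere colour {e₀} (proj₂ closeᶜ) refl refl closingᶜ
    ; others≈0 = others })
    where
    others : ∀ h → h ≢ f₀ → h ≢ e₀ → edgeValue (masked everywhere colour) h ≈ 0#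
    others h h≢f₀ h≢e₀ with covers h
    ... | inj₁ (inj₁ (i , j))        = masked-proper everywhere colour {h} j refl (properᶜ i)
    ... | inj₁ (inj₂ j)              = contradiction (joins-unique {e = h} {e₀} j (proj₂ closeᶜ)) h≢e₀
    ... | inj₂ (inj₁ (inj₁ (i , j))) = masked-proper everywhere colour {h} j refl (properᴰ i)
    ... | inj₂ (inj₁ (inj₂ j))       = contradiction (joins-unique {e = h} {f₀} j (proj₂ closeᴰ)) h≢f₀
    ... | inj₂ (inj₂ (i , j))        = masked-proper everywhere colour {h} j refl (properᴾ i)

  path-linked : ∀ {h} → P.EdgeOf h → Linked h e₀
  path-linked {h} (i , j) = inj₂ (masked near colour , record
    { first#0  = masked-boundary near colour {h} j λ eq → contradiction
        (≡.trans (≡.sym (≡.trans (nearᴾ (inject₁ i)) (upTo-self i)))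
          (≡.trans eq (≡.trans (nearᴾ (suc i)) (upTo-suc i)))) λ ()
    ; second#0 = masked-monochromatic near colour {e₀} (proj₂ closeᶜ)
        (nearᶜ (fromℕ _ , refl)) (nearᶜ (zero , refl)) closingᶜ
    ; others≈0 = others })
    where
    open Beyond i
    others : ∀ g → g ≢ h → g ≢ e₀ → edgeValue (masked near colour) g ≈ 0#
    others g g≢h g≢e₀ with covers g
    ... | inj₁ (inj₁ (i′ , j′)) = masked-proper near colour {g} j′
      (≡.trans (nearᶜ (inject₁ i′ , refl)) (≡.sym (nearᶜ (suc i′ , refl)))) (properᶜ i′)
    ... | inj₁ (inj₂ j′) = contradiction (joins-unique {e = g} {e₀} j′ (proj₂ closeᶜ)) g≢e₀
    ... | inj₂ (inj₁ g∈D) with lo∈D , hi∈D ← cycle-ends D g g∈D =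
      masked-outside near colour {g} (joins-self g) (nearᴰ lo∈D) (nearᴰ hi∈D)
    others g g≢h g≢e₀ | inj₂ (inj₂ (i′ , j′)) = masked-proper near colour {g} j′
      (≡.trans (nearᴾ (inject₁ i′))
        (≡.trans (upTo-step {i = i} {i′} λ { refl → g≢h (joins-unique {e = g} {h} j′ j) })
          (≡.sym (nearᴾ (suc i′)))))
      (properᴾ i′)

  all-linked : ∀ h → Linked h e₀
  all-linked h with covers h
  ... | inj₁ h∈C        = cycle-linked C k (λ {h} → attachᶜ {h}) {h} {e₀} h∈C (proj₂ closeᶜ)
  ... | inj₂ (inj₁ h∈D) = linked-trans
    (cycle-linked D l (λ {h} → attachᴰ {h}) {h} {f₀} h∈D (proj₂ closeᴰ)) closing-linked
  ... | inj₂ (inj₂ h∈P) = path-linked {h} h∈P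

  everyPair : EveryEdgePairIsSupportOfSquare
  everyPair e f e≢f with linked-trans (all-linked e) (linked-sym (all-linked f))
  ... | inj₁ e≡f     = contradiction e≡f e≢f
  ... | inj₂ (_ , s) = supportedOnPair⇒pairSupport s

open import Data.Nat.Base using (_+_)
open NormalGraphAlgebra using (EdgeSquare; EveryEdgePairIsSupportOfSquare)

theorem7p3 : ∀ {c ℓ₁ ℓ₂} (F : HeytingField c ℓ₁ ℓ₂) → CharacteristicNot2 F →
    (∀ (p : ℕ) (G : Graph p) → Connected G → HasSize G (p + 1) →
    EveryEdgePairIsSupportOfSquare F G →
    ¬ EdgeSquare F G × IsDoublyOddPaddle G)
    ×
    (∀ (p : ℕ) (G : Graph p) → IsDoublyOddPaddle G →
    EveryEdgePairIsSupportOfSquare F G)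
theorem7p3 F 2#0 = forward , λ p G paddle → PaddleSupports.everyPair F 2#0 (paddleParts paddle)
  where
  forward : ∀ p (G : Graph p) → Connected G → HasSize G (p + 1) →
            EveryEdgePairIsSupportOfSquare F G → ¬ EdgeSquare F G × IsDoublyOddPaddle G
  forward p G connected size pairs =
      not-edgeSquare pairs e≢f ntᵉ ntᶠ
    , PaddleConstruction.isDoublyOddPaddle connected S nontree
        (fundamentalCycle e monochromaticᵉ) (fundamentalCycle f monochromaticᶠ)
    where
    S = spanningTree connected (Edge.lo (Inverse.to size (subst Fin (ℕₚ.+-comm 1 p) zero)))
    open TreePotential F S
    open TreeWalk S
    found = two-nontree-edges S size
    e = proj₁ found
    f = proj₁ (proj₂ found)
    e≢f = proj₁ (proj₂ (proj₂ found))
    ntᵉ = proj₁ (proj₂ (proj₂ (proj₂ found)))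
    ntᶠ = proj₂ (proj₂ (proj₂ (proj₂ found)))
    nontree = isNontreePair pairs e≢f ntᵉ ntᶠ
    open IsNontreePair nontree using (monochromaticᵉ; monochromaticᶠ)
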